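{- Let $p,q\geq 2$ be integers and let $G$ be a finite semiregular simple graph with edge degree $p+q$, that is, a finite connected bipartite simple graph in which every edge connects a vertex of degree $p+1$ to a vertex of degree $q+1$. Then there exist a constant $C_G>0$ and a number $\beta\in[(pq)^{ -1/4},1)$, both depending only on $G$, such that for every function $f:E\to\mathbb{R}$ on the edges of $G$, every basepoint $v_0\in\widetilde{V}$ and every integer $r\geq 0$, $$\Big|M_{r,v_0}(f)-\frac{1}{|E|}\sum_{e\in E}f(e)\Big|\leq C_G\,\|f\|_2\,\beta^r .$$ In particular $C_G$ is independent of $v_0$.
   Context: $G$ is a graph with vertex set $V$ and edge set $E$; it is simple if it has no loops and no multiple edges. The edge degree of $e$ is the number of edges (other than $e$) meeting $e$ in either of its endpoints. A semiregular graph is a connected bipartite graph in which every edge connects a vertex of degree $p+1$ to one of degree $q+1$ (so that the edge degree is constant, equal to $p+q$). The universal cover $\widetilde{G}$ of $G$ is the tree, with vertex set $\widetilde{V}$ and edge set $\widetilde{E}$, whose vertices are the non-backtracking paths in $G$ starting at a fixed root vertex, two such paths being neighbours if they differ by exactly one edge at the end. The projection $\pi:\widetilde{G}\to G$ sends a path to its terminal vertex, and an edge of $\widetilde{G}$ to the edge of $G$ by which the two paths differ. The lift of $f:E\to\mathbb{R}$ is $\tilde f=f\circ\pi:\widetilde{E}\to\mathbb{R}$. With $\delta$ the combinatorial distance between vertices of $\widetilde{G}$, the edge sphere is $$S'_r(v_0)=\{e=\{x,y\}\in\widetilde{E}:\min\{\delta(x,v_0),\delta(y,v_0)\}=r\},$$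 and the spherical mean is $$M_{r,v_0}(f)=\frac{1}{|S'_r(v_0)|}\sum_{e\in S'_r(v_0)}\tilde f(e).$$ The norm is $\|f\|_2=\big(\sum_{e\in E}f(e)^2\big)^{1/2}$. -}

module Defs where

open import Data.Nat.Base as ℕ using (ℕ; zero; suc)
import Data.Nat.Properties as ℕ
open import Data.Integer.Base as ℤ using (+_; +[1+_]; -[1+_])
import Data.Integer.Properties as ℤ
open import Data.Rational.Base as ℚ
  using (ℚ; mkℚ; 0ℚ; 1ℚ; ½; _+_; _-_; _*_; -_; ∣_∣; _≤_; _<_; _/_)
import Data.Rational.Properties as ℚ
import Data.Rational.Unnormalised.Base as ℚᵘ
import Data.Rational.Unnormalised.Properties as ℚᵘ
open import Data.Rational.Solver using (module +-*-Solver)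
open import Data.Product.Base using (∃; ∃-syntax; _×_; _,_; proj₁; proj₂)
open import Data.Sum.Base using (_⊎_; inj₁; inj₂; [_,_]′; map₁)
open import Data.List.Base
  using (List; []; _∷_; _++_; foldr; length; filter; filterᵇ; deduplicate; concatMap; allFin)
open import Data.List.Membership.Propositional using (_∈_; find; lose)
open import Data.List.Membership.Propositional.Properties
  using (∈-filter⁺; ∈-filter⁻; ∈-deduplicate⁺; ∈-concatMap⁺; ∈-allFin; ∈-++⁺ˡ; ∈-++⁺ʳ)
open import Data.List.Relation.Unary.Any using (here; any?)
open import Data.List.Relation.Unary.Unique.Propositional using (Unique)
open import Data.List.Relation.Unary.Unique.Propositional.Properties using (filter⁺)
open import Data.List.Relation.Unary.Unique.DecPropositional.Properties using (deduplicate-!)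
open import Data.Bool.Base using (Bool; T)
open import Data.Bool.Properties using (T?)
open import Data.Empty using (⊥-elim-irr)
open import Data.Fin.Base as Fin using (Fin)
import Data.Fin.Properties as Fin
open import Data.Unit.Base using (⊤; tt)
open import Relation.Binary.Definitions using (DecidableEquality; tri<; tri≈; tri>)
open import Relation.Nullary.Decidable
  using (Dec; yes; no; from-yes; map′; ¬?; _×-dec_; _⊎-dec_)
open import Relation.Nullary.Negation using (¬_; contradiction)
open import Relation.Binary.PropositionalEquality

private
  open +-*-Solver using (solve; con; _:=_; _:+_; _:*_; _:-_; :-_)
  open ℚ.≤-Reasoning

  0<½ : 0ℚ < ½
  0<½ = from-yes (0ℚ ℚ.<? ½)

  0<1 : 0ℚ < 1ℚ
  0<1 = from-yes (0ℚ ℚ.<? 1ℚ)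

  *-pos : ∀ {x y} → 0ℚ < x → 0ℚ < y → 0ℚ < x * y
  *-pos {x} {y} 0<x 0<y =
    ℚ.positive⁻¹ (x * y) {{ℚ.pos*pos⇒pos x {{ℚ.positive 0<x}} y {{ℚ.positive 0<y}}}}

  half : ℚ → ℚ
  half ε = ½ * ε

  half-pos : ∀ {ε} → 0ℚ < ε → 0ℚ < half ε
  half-pos = *-pos 0<½

  half+half : ∀ ε → half ε + half ε ≡ ε
  half+half = solve 1 (λ e → con ½ :* e :+ con ½ :* e := e) refl

  sq-mono : ∀ {x y} → 0ℚ ≤ x → x ≤ y → x * x ≤ y * y
  sq-mono {x} {y} 0≤x x≤y = ℚ.≤-trans
    (ℚ.*-monoˡ-≤-nonNeg x {{ℚ.nonNegative 0≤x}} x≤y)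
    (ℚ.*-monoʳ-≤-nonNeg y {{ℚ.nonNegative (ℚ.≤-trans 0≤x x≤y)}} x≤y)

  ∣∣-< : ∀ {x ε} → x < ε → - x < ε → ∣ x ∣ < ε
  ∣∣-< {x} {ε} x<ε -x<ε with ℚ.∣p∣≡p∨∣p∣≡-p x
  ... | inj₁ eq = subst (_< ε) (sym eq) x<ε
  ... | inj₂ eq = subst (_< ε) (sym eq) -x<ε

  x≤∣x∣ : ∀ x → x ≤ ∣ x ∣
  x≤∣x∣ x with ℚ.≤-total 0ℚ x
  ... | inj₁ 0≤x = ℚ.≤-reflexive (sym (ℚ.0≤p⇒∣p∣≡p 0≤x))
  ... | inj₂ x≤0 = ℚ.≤-trans x≤0 (ℚ.0≤∣p∣ x)

-- 0⁻¹ = 0 by convention, so that the mean over an empty list is 0.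
recip : ℕ → ℚ
recip zero    = 0ℚ
recip (suc n) = + 1 / suc n

toℚᵘ-/ : ∀ k d → ℚ.toℚᵘ (k / suc d) ℚᵘ.≃ ℚᵘ.mkℚᵘ k d
toℚᵘ-/ k d = ℚ.toℚᵘ-fromℚᵘ (ℚᵘ.mkℚᵘ k d)

recip-pos : ∀ n → 0ℚ < recip (suc n)
recip-pos n = ℚ.positive⁻¹ (recip (suc n)) {{ℚ.normalize-pos 1 (suc n)}}

archimedean : ∀ ε → 0ℚ < ε → ∃[ N ] ∀ n → N ℕ.≤ n → recip (suc n) ≤ ε
archimedean (mkℚ (+ 0) d c) (ℚ.*<* (ℤ.+<+ ()))
archimedean (mkℚ -[1+ _ ] d c) (ℚ.*<* ())
archimedean (mkℚ +[1+ a ] d c) _ = suc d , λ n d<n → ℚ.toℚᵘ-cancel-≤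
  (ℚᵘ.≤-respˡ-≃ (ℚᵘ.≃-sym (toℚᵘ-/ (+ 1) n))
    (ℚᵘ.*≤* (ℤ.≤-trans (ℤ.≤-reflexive (ℤ.*-identityˡ (+ suc d)))
      (ℤ.+≤+ (ℕ.≤-trans d<n (ℕ.≤-trans (ℕ.n≤1+n n) (ℕ.m≤m+n (suc n) (a ℕ.* suc n))))))))

-- Reals are Cauchy sequences of rationals with pointwise operations; equality
-- is _≃ᴿ_.
Cauchy : (ℕ → ℚ) → Set
Cauchy s = ∀ ε → 0ℚ < ε → ∃[ N ] ∀ m n → N ℕ.≤ m → N ℕ.≤ n → ∣ s m - s n ∣ < ε

record ℝ : Set where
  constructor mkℝ
  field
    seq    : ℕ → ℚ
    cauchy : Cauchy seq
open ℝ public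

infix  4 _≤ᴿ_ _<ᴿ_ _≃ᴿ_
infixl 6 _+ᴿ_ _-ᴿ_
infixl 7 _*ᴿ_
infix  8 -ᴿ_
infixr 8 _^ᴿ_

_≤ᴿ_ : ℝ → ℝ → Set
x ≤ᴿ y = ∀ ε → 0ℚ < ε → ∃[ N ] ∀ n → N ℕ.≤ n → seq x n ≤ seq y n + ε

_<ᴿ_ : ℝ → ℝ → Set
x <ᴿ y = ∃[ ε ] 0ℚ < ε × (∃[ N ] ∀ n → N ℕ.≤ n → seq x n + ε ≤ seq y n)

_≃ᴿ_ : ℝ → ℝ → Set
x ≃ᴿ y = x ≤ᴿ y × y ≤ᴿ x

fromℚ : ℚ → ℝ
fromℚ p = mkℝ (λ _ → p) λ ε 0<ε → 0 , λ _ _ _ _ →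
  subst (λ z → ∣ z ∣ < ε) (sym (ℚ.+-inverseʳ p)) 0<ε

0ᴿ 1ᴿ : ℝ
0ᴿ = fromℚ 0ℚ
1ᴿ = fromℚ 1ℚ

_+ᴿ_ : ℝ → ℝ → ℝ
x +ᴿ y = mkℝ (λ n → seq x n + seq y n) λ ε 0<ε →
  let N , hx = cauchy x (half ε) (half-pos 0<ε)
      M , hy = cauchy y (half ε) (half-pos 0<ε)
  in N ℕ.⊔ M , λ m n m≥ n≥ → begin-strict
    ∣ (seq x m + seq y m) - (seq x n + seq y n) ∣
      ≡⟨ cong ∣_∣ (solve 4 (λ a b c d → (a :+ b) :- (c :+ d) := (a :- c) :+ (b :- d))
                 refl (seq x m) (seq y m) (seq x n) (seq y n)) ⟩
    ∣ (seq x m - seq x n) + (seq y m - seq y n) ∣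
      ≤⟨ ℚ.∣p+q∣≤∣p∣+∣q∣ (seq x m - seq x n) (seq y m - seq y n) ⟩
    ∣ seq x m - seq x n ∣ + ∣ seq y m - seq y n ∣
      <⟨ ℚ.+-mono-< (hx m n (ℕ.m⊔n≤o⇒m≤o N M m≥) (ℕ.m⊔n≤o⇒m≤o N M n≥))
                    (hy m n (ℕ.m⊔n≤o⇒n≤o N M m≥) (ℕ.m⊔n≤o⇒n≤o N M n≥)) ⟩
    half ε + half ε
      ≡⟨ half+half ε ⟩
    ε ∎

-ᴿ_ : ℝ → ℝ
-ᴿ x = mkℝ (λ n → - seq x n) λ ε 0<ε →
  let N , h = cauchy x ε 0<ε
  in N , λ m n m≥ n≥ → subst (_< ε)
       (trans (sym (ℚ.∣-p∣≡∣p∣ (seq x m - seq x n)))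
         (cong ∣_∣ (solve 2 (λ a b → :- (a :- b) := :- a :- (:- b)) refl (seq x m) (seq x n))))
       (h m n m≥ n≥)

_-ᴿ_ : ℝ → ℝ → ℝ
x -ᴿ y = x +ᴿ (-ᴿ y)

private
  ∣∣-shift : ∀ x y → ∣ x ∣ ≤ ∣ y ∣ + ∣ x - y ∣
  ∣∣-shift x y = subst (λ z → ∣ z ∣ ≤ ∣ y ∣ + ∣ x - y ∣)
    (solve 2 (λ x y → y :+ (x :- y) := x) refl x y) (ℚ.∣p+q∣≤∣p∣+∣q∣ y (x - y))

  bounded : ∀ x → ∃[ B ] 0ℚ < B × (∃[ N ] ∀ n → N ℕ.≤ n → ∣ seq x n ∣ ≤ B)
  bounded x with cauchy x 1ℚ 0<1
  ... | N , h = ∣ seq x N ∣ + 1ℚ , ℚ.+-mono-≤-< (ℚ.0≤∣p∣ (seq x N)) 0<1 , N , λ n n≥ →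
        ℚ.≤-trans (∣∣-shift (seq x n) (seq x N))
          (ℚ.+-monoʳ-≤ ∣ seq x N ∣ (ℚ.<⇒≤ (h n N n≥ ℕ.≤-refl)))

  shrink : ∀ ε → 0ℚ < ε → ∀ B → 0ℚ < B → ∃[ δ ] 0ℚ < δ × B * δ ≡ half ε
  shrink ε 0<ε B 0<B =
      1/B * half ε
    , *-pos (ℚ.positive⁻¹ 1/B {{ℚ.1/pos⇒pos B {{ℚ.positive 0<B}}}}) (half-pos 0<ε)
    , (begin-equality
        B * (1/B * half ε) ≡⟨ ℚ.*-assoc B 1/B (half ε) ⟨
        B * 1/B * half ε   ≡⟨ cong (_* half ε) (ℚ.*-inverseʳ B {{B≢0}}) ⟩
        1ℚ * half ε        ≡⟨ ℚ.*-identityˡ (half ε) ⟩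
        half ε             ∎)
    where
    B≢0 = ℚ.>-nonZero 0<B
    1/B = ℚ.1/_ B {{B≢0}}

_*ᴿ_ : ℝ → ℝ → ℝ
x *ᴿ y = mkℝ (λ n → seq x n * seq y n) λ ε 0<ε →
  let A , 0<A , N₁ , bx = bounded x
      B , 0<B , N₂ , by = bounded y
      δ , 0<δ , Aδ = shrink ε 0<ε A 0<A
      γ , 0<γ , Bγ = shrink ε 0<ε B 0<B
      N₃ , hx = cauchy x γ 0<γ
      N₄ , hy = cauchy y δ 0<δ
      N₁₂ = N₁ ℕ.⊔ N₂
      N₃₄ = N₃ ℕ.⊔ N₄
      l : ∀ {m} → N₁₂ ℕ.⊔ N₃₄ ℕ.≤ m → N₁₂ ℕ.≤ m
      l = ℕ.m⊔n≤o⇒m≤o N₁₂ N₃₄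
      r : ∀ {m} → N₁₂ ℕ.⊔ N₃₄ ℕ.≤ m → N₃₄ ℕ.≤ m
      r = ℕ.m⊔n≤o⇒n≤o N₁₂ N₃₄
  in N₁₂ ℕ.⊔ N₃₄ , λ m n m≥ n≥ →
    let a = seq x m
        b = seq y m
        c = seq x n
        d = seq y n
    in begin-strict
    ∣ a * b - c * d ∣
      ≡⟨ cong ∣_∣ (solve 4 (λ a b c d → a :* b :- c :* d := a :* (b :- d) :+ d :* (a :- c))
                 refl a b c d) ⟩
    ∣ a * (b - d) + d * (a - c) ∣
      ≤⟨ ℚ.∣p+q∣≤∣p∣+∣q∣ (a * (b - d)) (d * (a - c)) ⟩
    ∣ a * (b - d) ∣ + ∣ d * (a - c) ∣
      ≡⟨ cong₂ _+_ (ℚ.∣p*q∣≡∣p∣*∣q∣ a (b - d)) (ℚ.∣p*q∣≡∣p∣*∣q∣ d (a - c)) ⟩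
    ∣ a ∣ * ∣ b - d ∣ + ∣ d ∣ * ∣ a - c ∣
      ≤⟨ ℚ.+-mono-≤
          (ℚ.*-monoʳ-≤-nonNeg ∣ b - d ∣ {{ℚ.∣-∣-nonNeg (b - d)}}
            (bx m (ℕ.m⊔n≤o⇒m≤o N₁ N₂ (l m≥))))
          (ℚ.*-monoʳ-≤-nonNeg ∣ a - c ∣ {{ℚ.∣-∣-nonNeg (a - c)}}
            (by n (ℕ.m⊔n≤o⇒n≤o N₁ N₂ (l n≥)))) ⟩
    A * ∣ b - d ∣ + B * ∣ a - c ∣
      <⟨ ℚ.+-mono-<
          (ℚ.*-monoʳ-<-pos A {{ℚ.positive 0<A}}
            (hy m n (ℕ.m⊔n≤o⇒n≤o N₃ N₄ (r m≥)) (ℕ.m⊔n≤o⇒n≤o N₃ N₄ (r n≥))))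
          (ℚ.*-monoʳ-<-pos B {{ℚ.positive 0<B}}
            (hx m n (ℕ.m⊔n≤o⇒m≤o N₃ N₄ (r m≥)) (ℕ.m⊔n≤o⇒m≤o N₃ N₄ (r n≥)))) ⟩
    A * δ + B * γ
      ≡⟨ cong₂ _+_ Aδ Bγ ⟩
    half ε + half ε
      ≡⟨ half+half ε ⟩
    ε ∎

_^ᴿ_ : ℝ → ℕ → ℝ
x ^ᴿ zero  = 1ᴿ
x ^ᴿ suc n = x *ᴿ x ^ᴿ n

∣_∣ᴿ : ℝ → ℝ
∣ x ∣ᴿ = mkℝ (λ n → ∣ seq x n ∣) λ ε 0<ε →
  let N , h = cauchy x ε 0<ε
      le : ∀ a b → ∣ a ∣ - ∣ b ∣ ≤ ∣ a - b ∣
      le a b = begin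
        ∣ a ∣ - ∣ b ∣               ≤⟨ ℚ.+-monoˡ-≤ (- ∣ b ∣) (∣∣-shift a b) ⟩
        ∣ b ∣ + ∣ a - b ∣ - ∣ b ∣   ≡⟨ solve 2 (λ b c → b :+ c :- b := c) refl ∣ b ∣ ∣ a - b ∣ ⟩
        ∣ a - b ∣                   ∎
  in N , λ m n m≥ n≥ → ∣∣-<
    (ℚ.≤-<-trans (le (seq x m) (seq x n)) (h m n m≥ n≥))
    (subst (_< ε) (solve 2 (λ a b → b :- a := :- (a :- b)) refl ∣ seq x m ∣ ∣ seq x n ∣)
      (ℚ.≤-<-trans (le (seq x n) (seq x m)) (h n m n≥ m≥)))

grid : ℕ → ℕ → ℚ
grid k j = + j / suc k

private
  grid-suc : ∀ k j → grid k (suc j) ≡ grid k j + recip (suc k)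
  grid-suc k j = ℚ.toℚᵘ-injective (ℚᵘ.≃-trans (toℚᵘ-/ (+ suc j) k)
    (ℚᵘ.≃-sym (ℚᵘ.≃-trans (ℚ.toℚᵘ-homo-+ (grid k j) (recip (suc k)))
      (ℚᵘ.≃-trans (ℚᵘ.+-cong (toℚᵘ-/ (+ j) k) (toℚᵘ-/ (+ 1) k))
        (ℚᵘ.*≡* lem)))))
    where
    lem : (+ j ℤ.* + suc k ℤ.+ + 1 ℤ.* + suc k) ℤ.* + suc k ≡ + suc j ℤ.* + (suc k ℕ.* suc k)
    lem = trans (cong (ℤ._* + suc k) (sym (ℤ.*-distribʳ-+ (+ suc k) (+ j) (+ 1))))
      (trans (ℤ.*-assoc (+ j ℤ.+ + 1) (+ suc k) (+ suc k))
        (cong₂ ℤ._*_ (cong +_ (ℕ.+-comm j 1)) (sym (ℤ.pos-* (suc k) (suc k)))))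

  grid-zero : ∀ k → grid k 0 ≡ 0ℚ
  grid-zero k = ℚ.0/n≡0 (suc k)

  grid-nonNeg : ∀ k j → 0ℚ ≤ grid k j
  grid-nonNeg k j = ℚ.nonNegative⁻¹ (grid k j) {{ℚ.normalize-nonNeg j (suc k)}}

  grid-full : ∀ k c → grid k (suc k ℕ.* c) ≡ + c / 1
  grid-full k c = ℚ.toℚᵘ-injective (ℚᵘ.≃-trans (toℚᵘ-/ (+ (suc k ℕ.* c)) k)
    (ℚᵘ.≃-trans (ℚᵘ.*≡* (trans (ℤ.*-identityʳ (+ (suc k ℕ.* c)))
        (cong +_ (ℕ.*-comm (suc k) c)) ⟨trans⟩ ℤ.pos-* c (suc k)))
      (ℚᵘ.≃-sym (toℚᵘ-/ (+ c) 0))))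
    where _⟨trans⟩_ = trans

  largest : {P : ℕ → Set} → (∀ j → Dec (P j)) → ∀ b → ¬ P (suc b) →
    ∃[ j ] (j ≡ 0 ⊎ P j) × ¬ P (suc j)
  largest P? zero    ¬P = 0 , inj₁ refl , ¬P
  largest P? (suc b) ¬P with P? (suc b)
  ... | yes p = suc b , inj₂ p , ¬P
  ... | no ¬p = largest P? b ¬p

  a≤↥a : ∀ a → a ≤ + ℤ.∣ ℚ.↥ a ∣ / 1
  a≤↥a a@(mkℚ n d c) = ℚ.toℚᵘ-cancel-≤ (ℚᵘ.≤-respʳ-≃ (ℚᵘ.≃-sym (toℚᵘ-/ (+ ℤ.∣ n ∣) 0))
    (ℚᵘ.*≤* (lem n)))
    where
    lem : ∀ n → n ℤ.* + 1 ℤ.≤ + ℤ.∣ n ∣ ℤ.* + suc d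
    lem (+ m) = subst₂ ℤ._≤_ (sym (ℤ.*-identityʳ (+ m))) (ℤ.pos-* m (suc d))
                  (ℤ.+≤+ (ℕ.m≤m*n m (suc d)))
    lem -[1+ m ] = ℤ.-≤+

  sq-incr : ∀ {x} → 1ℚ ≤ x → x ≤ x * x
  sq-incr {x} 1≤x = subst (_≤ x * x) (ℚ.*-identityˡ x)
    (ℚ.*-monoʳ-≤-nonNeg x {{ℚ.nonNegative (ℚ.≤-trans (ℚ.<⇒≤ 0<1) 1≤x)}} 1≤x)

  root-bound : ∀ k a → ¬ grid k (suc (suc k ℕ.* suc ℤ.∣ ℚ.↥ a ∣)) *
                         grid k (suc (suc k ℕ.* suc ℤ.∣ ℚ.↥ a ∣)) ≤ a
  root-bound k a le = ℚ.<-irrefl refl (begin-strict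
      a              ≤⟨ a≤↥a a ⟩
      + N / 1        ≡⟨ ℚ.+-identityʳ (+ N / 1) ⟨
      + N / 1 + 0ℚ   ≤⟨ ℚ.+-monoʳ-≤ (+ N / 1) (ℚ.<⇒≤ 0<1) ⟩
      + N / 1 + 1ℚ   ≡⟨ 1+N ⟨
      N+1            <⟨ N+1<g ⟩
      g              ≤⟨ sq-incr (ℚ.≤-trans 1≤N+1 (ℚ.<⇒≤ N+1<g)) ⟩
      g * g          ≤⟨ le ⟩
      a              ∎)
    where
    N = ℤ.∣ ℚ.↥ a ∣
    b = suc k ℕ.* suc N
    N+1 = + suc N / 1
    1+N : N+1 ≡ + N / 1 + 1ℚ
    1+N = grid-suc 0 N
    g = grid k (suc b)
    N+1<g : N+1 < g
    N+1<g = subst₂ _<_ (trans (ℚ.+-identityʳ (grid k b)) (grid-full k (suc N))) (sym (grid-suc k b))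
      (ℚ.+-monoʳ-< (grid k b) (recip-pos k))
    1≤N+1 : 1ℚ ≤ N+1
    1≤N+1 = subst₂ _≤_ (ℚ.+-identityˡ 1ℚ) (sym 1+N) (ℚ.+-monoˡ-≤ 1ℚ (grid-nonNeg 0 N))

-- √a rounded down to a multiple of 1/(k+1) (or 0 if a < 0).
opaque
  root-floor : ∀ k a → ∃[ j ] (j ≡ 0 ⊎ grid k j * grid k j ≤ a) ×
                              ¬ grid k (suc j) * grid k (suc j) ≤ a
  root-floor k a = largest (λ j → grid k j * grid k j ℚ.≤? a)
                     (suc k ℕ.* suc ℤ.∣ ℚ.↥ a ∣) (root-bound k a)

rootℚ : ℕ → ℚ → ℚ
rootℚ k a = grid k (proj₁ (root-floor k a))

rootℚ-nonNeg : ∀ k a → 0ℚ ≤ rootℚ k a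
rootℚ-nonNeg k a = grid-nonNeg k (proj₁ (root-floor k a))

rootℚ-lower : ∀ k a → rootℚ k a ≡ 0ℚ ⊎ rootℚ k a * rootℚ k a ≤ a
rootℚ-lower k a = map₁ (λ eq → trans (cong (grid k) eq) (grid-zero k))
                    (proj₁ (proj₂ (root-floor k a)))

rootℚ-upper : ∀ k a → a < (rootℚ k a + recip (suc k)) * (rootℚ k a + recip (suc k))
rootℚ-upper k a = subst (λ z → a < z * z) (grid-suc k (proj₁ (root-floor k a)))
                    (ℚ.≰⇒> (proj₂ (proj₂ (root-floor k a))))

private
  root-close : ∀ {ε} → 0ℚ < ε → ∀ u v t a b → 0ℚ ≤ v → 0ℚ ≤ t → t ≤ half ε →
    u ≡ 0ℚ ⊎ u * u ≤ a → b < (v + t) * (v + t) →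
    ∣ a - b ∣ < half ε * half ε → u - v < ε
  root-close {ε} 0<ε u v t a b 0≤v 0≤t t≤h lower upper a-b< = ℚ.≰⇒> absurd
    where
    w = v + t
    h = half ε
    0≤h : 0ℚ ≤ h
    0≤h = ℚ.<⇒≤ (half-pos 0<ε)
    0≤w : 0ℚ ≤ w
    0≤w = ℚ.+-mono-≤ 0≤v 0≤t
    0≤wh : 0ℚ ≤ w * h
    0≤wh = ℚ.nonNegative⁻¹ (w * h)
      {{ℚ.nonNeg*nonNeg⇒nonNeg w {{ℚ.nonNegative 0≤w}} h {{ℚ.nonNegative 0≤h}}}}
    absurd : ε ≤ u - v → _
    absurd ε≤u-v = ℚ.<-irrefl refl (begin-strict
      b + h * h                        <⟨ ℚ.+-monoˡ-< (h * h) upper ⟩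
      w * w + h * h                    ≡⟨ ℚ.+-identityʳ _ ⟨
      w * w + h * h + 0ℚ               ≤⟨ ℚ.+-monoʳ-≤ (w * w + h * h) (ℚ.+-mono-≤ 0≤wh 0≤wh) ⟩
      w * w + h * h + (w * h + w * h)  ≡⟨ solve 2 (λ w h → w :* w :+ h :* h :+ (w :* h :+ w :* h)
                                                     := (w :+ h) :* (w :+ h)) refl w h ⟩
      (w + h) * (w + h)                ≤⟨ sq-mono (ℚ.+-mono-≤ 0≤w 0≤h) w+h≤u ⟩
      u * u                            ≤⟨ u²≤a ⟩
      a                                ≡⟨ solve 2 (λ a b → a := b :+ (a :- b)) refl a b ⟩
      b + (a - b)                      ≤⟨ ℚ.+-monoʳ-≤ b (x≤∣x∣ (a - b)) ⟩
      b + ∣ a - b ∣                    <⟨ ℚ.+-monoʳ-< b a-b< ⟩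
      b + h * h                        ∎)
      where
      v+ε≤u : v + ε ≤ u
      v+ε≤u = subst (v + ε ≤_) (solve 2 (λ u v → v :+ (u :- v) := u) refl u v)
                (ℚ.+-monoʳ-≤ v ε≤u-v)
      w+h≤u : w + h ≤ u
      w+h≤u = begin
        v + t + h    ≤⟨ ℚ.+-monoˡ-≤ h (ℚ.+-monoʳ-≤ v t≤h) ⟩
        v + h + h    ≡⟨ ℚ.+-assoc v h h ⟩
        v + (h + h)  ≡⟨ cong (λ z → v + z) (half+half ε) ⟩
        v + ε        ≤⟨ v+ε≤u ⟩
        u            ∎
      u≢0 : u ≢ 0ℚ
      u≢0 u≡0 = ℚ.<-irrefl (sym u≡0) (ℚ.<-≤-trans (ℚ.+-mono-≤-< 0≤v 0<ε) v+ε≤u)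
      u²≤a : u * u ≤ a
      u²≤a = [ (λ eq → contradiction eq u≢0) , (λ p → p) ]′ lower

infix 9 √_

-- √ x for x ≥ 0 (and √ x = 0 for x ≤ 0).
√_ : ℝ → ℝ
√ x = mkℝ (λ n → rootℚ n (seq x n)) λ ε 0<ε →
  let N₁ , h = cauchy x (half ε * half ε) (*-pos (half-pos 0<ε) (half-pos 0<ε))
      N₂ , r = archimedean (half ε) (half-pos 0<ε)
      le : ∀ m n → N₁ ℕ.⊔ N₂ ℕ.≤ m → N₁ ℕ.⊔ N₂ ℕ.≤ n →
           rootℚ m (seq x m) - rootℚ n (seq x n) < ε
      le m n m≥ n≥ = root-close 0<ε (rootℚ m (seq x m)) (rootℚ n (seq x n)) (recip (suc n))
        (seq x m) (seq x n) (rootℚ-nonNeg n (seq x n)) (ℚ.<⇒≤ (recip-pos n))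
        (r n (ℕ.m⊔n≤o⇒n≤o N₁ N₂ n≥)) (rootℚ-lower m (seq x m)) (rootℚ-upper n (seq x n))
        (h m n (ℕ.m⊔n≤o⇒m≤o N₁ N₂ m≥) (ℕ.m⊔n≤o⇒m≤o N₁ N₂ n≥))
  in N₁ ℕ.⊔ N₂ , λ m n m≥ n≥ → ∣∣-< (le m n m≥ n≥)
    (subst (_< ε) (solve 2 (λ u v → v :- u := :- (u :- v)) refl
        (rootℚ m (seq x m)) (rootℚ n (seq x n)))
      (le n m n≥ m≥))

√-square : ∀ x → 0ᴿ ≤ᴿ x → √ x *ᴿ √ x ≃ᴿ x
√-square x 0≤x = lower , upper
  where
  lower : √ x *ᴿ √ x ≤ᴿ x
  lower ε 0<ε = let N , h = 0≤x ε 0<ε in N , λ n n≥ → go n (h n n≥)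
    where
    go : ∀ n → 0ℚ ≤ seq x n + ε → seq (√ x) n * seq (√ x) n ≤ seq x n + ε
    go n 0≤xε with rootℚ-lower n (seq x n)
    ... | inj₁ eq = subst (λ z → z * z ≤ seq x n + ε) (sym eq) 0≤xε
    ... | inj₂ le = ℚ.≤-trans le (subst (_≤ seq x n + ε) (ℚ.+-identityʳ (seq x n))
                      (ℚ.+-monoʳ-≤ (seq x n) (ℚ.<⇒≤ 0<ε)))
  upper : x ≤ᴿ √ x *ᴿ √ x
  upper ε 0<ε =
    let B , 0<B , N₁ , bd = bounded (√ x)
        C = B + B + 1ℚ
        0<C : 0ℚ < C
        0<C = ℚ.+-mono-< (ℚ.+-mono-< 0<B 0<B) 0<1
        δ , 0<δ , Cδ = shrink ε 0<ε C 0<C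
        N₂ , r₁ = archimedean δ 0<δ
        N₃ , r₂ = archimedean 1ℚ 0<1
    in N₁ ℕ.⊔ (N₂ ℕ.⊔ N₃) , λ n n≥ →
      let u = seq (√ x) n
          t = recip (suc n)
          m≥ = ℕ.m⊔n≤o⇒n≤o N₁ (N₂ ℕ.⊔ N₃) n≥
          u≤B : u ≤ B
          u≤B = ℚ.≤-trans (x≤∣x∣ u) (bd n (ℕ.m⊔n≤o⇒m≤o N₁ (N₂ ℕ.⊔ N₃) n≥))
          t≤δ = r₁ n (ℕ.m⊔n≤o⇒m≤o N₂ N₃ m≥)
          t≤1 = r₂ n (ℕ.m⊔n≤o⇒n≤o N₂ N₃ m≥)
      in begin
        seq x n                  ≤⟨ ℚ.<⇒≤ (rootℚ-upper n (seq x n)) ⟩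
        (u + t) * (u + t)        ≡⟨ solve 2 (λ u t → (u :+ t) :* (u :+ t)
                                              := u :* u :+ (u :+ u :+ t) :* t) refl u t ⟩
        u * u + (u + u + t) * t  ≤⟨ ℚ.+-monoʳ-≤ (u * u) (begin
          (u + u + t) * t ≤⟨ ℚ.*-monoʳ-≤-nonNeg t {{ℚ.nonNegative (ℚ.<⇒≤ (recip-pos n))}}
                               (ℚ.+-mono-≤ (ℚ.+-mono-≤ u≤B u≤B) t≤1) ⟩
          C * t           ≤⟨ ℚ.*-monoˡ-≤-nonNeg C {{ℚ.nonNegative (ℚ.<⇒≤ 0<C)}} t≤δ ⟩
          C * δ           ≡⟨ Cδ ⟩
          half ε          ≡⟨ ℚ.+-identityʳ (half ε) ⟨
          half ε + 0ℚ     ≤⟨ ℚ.+-monoʳ-≤ (half ε) (ℚ.<⇒≤ (half-pos 0<ε)) ⟩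
          half ε + half ε ≡⟨ half+half ε ⟩
          ε               ∎) ⟩
        u * u + ε                ∎

sumᴿ : {A : Set} → (A → ℝ) → List A → ℝ
sumᴿ f = foldr (λ a s → f a +ᴿ s) 0ᴿ

meanᴿ : {A : Set} → (A → ℝ) → List A → ℝ
meanᴿ f xs = fromℚ (recip (length xs)) *ᴿ sumᴿ f xs

record Enumeration {A : Set} (P : A → Set) : Set where
  field
    list     : List A
    unique   : Unique list
    sound    : ∀ {a} → a ∈ list → P a
    complete : ∀ {a} → P a → a ∈ list

private
  enumerate : {A : Set} {P : A → Set} → DecidableEquality A → (∀ a → Dec (P a)) →
    (as : List A) → (∀ {a} → P a → a ∈ as) → Enumeration P
  enumerate _≟_ P? as h = record
    { list     = filter P? (deduplicate _≟_ as)
    ; unique   = filter⁺ P? (deduplicate-! _≟_ as)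
    ; sound    = λ a∈ → proj₂ (∈-filter⁻ P? {xs = deduplicate _≟_ as} a∈)
    ; complete = λ Pa → ∈-filter⁺ P? (∈-deduplicate⁺ _≟_ (h Pa)) Pa
    }

  least : {P : ℕ → Set} → (∀ n → Dec (P n)) → ∀ n → P n →
    ∃[ m ] P m × (∀ k → P k → m ℕ.≤ k)
  least P? zero    Pn = 0 , Pn , λ _ _ → ℕ.z≤n
  least P? (suc n) Pn with P? 0
  ... | yes P0 = 0 , P0 , λ _ _ → ℕ.z≤n
  ... | no ¬P0 with least (λ k → P? (suc k)) n Pn
  ...   | m , Pm , m≤ = suc m , Pm , λ
          { zero    P0 → contradiction P0 ¬P0
          ; (suc k) Pk → ℕ.s≤s (m≤ k Pk) }

module Walks {A : Set} (_~_ : A → A → Set) where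

  data Walk (x : A) : A → ℕ → Set where
    []   : Walk x x 0
    step : ∀ {y z n} → x ~ y → Walk y z n → Walk x z (suc n)

  Connected : Set
  Connected = ∀ x y → ∃[ n ] Walk x y n

  IsDistance : A → A → ℕ → Set
  IsDistance x y d = Walk x y d × (∀ n → Walk x y n → d ℕ.≤ n)

  snoc : ∀ {x y z n} → Walk x y n → y ~ z → Walk x z (suc n)
  snoc []         s = step s []
  snoc (step t w) s = step t (snoc w s)

  append : ∀ {x y z m n} → Walk x y m → Walk y z n → Walk x z (m ℕ.+ n)
  append []         w = w
  append (step s v) w = step s (append v w)

  reverse : (∀ {x y} → x ~ y → y ~ x) → ∀ {x y n} → Walk x y n → Walk y x n
  reverse ~-sym []         = []
  reverse ~-sym (step s w) = snoc (reverse ~-sym w) (~-sym s)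

  module Distances
    (_≟_ : DecidableEquality A) (neighbours : ∀ x → Enumeration (x ~_)) (connected : Connected)
    where

    private
      module N x = Enumeration (neighbours x)

    walk? : ∀ n x y → Dec (Walk x y n)
    walk? zero x y = map′ (λ { refl → [] }) (λ { [] → refl }) (x ≟ y)
    walk? (suc n) x y = map′
      (λ w → let z , z∈ , w′ = find w in step (N.sound x z∈) w′)
      (λ { (step s w) → lose (N.complete x s) w })
      (any? (λ z → walk? n z y) (N.list x))

    opaque
      distance : ∀ x y → ∃[ d ] IsDistance x y d
      distance x y =
        let n , w = connected x y
            d , v , d≤ = least (λ m → walk? m x y) n w
        in d , v , d≤

    δ : A → A → ℕ
    δ x y = proj₁ (distance x y)

    reachable : ℕ → A → List A
    reachable zero    x = x ∷ []
    reachable (suc n) x = concatMap (reachable n) (N.list x)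

    ∈-reachable : ∀ {n x y} → Walk x y n → y ∈ reachable n x
    ∈-reachable []         = here refl
    ∈-reachable {suc n} {x} (step s w) =
      ∈-concatMap⁺ (reachable n) (lose (N.complete x s) (∈-reachable w))

record SimpleGraph : Set where
  field
    order    : ℕ
    adj      : Fin order → Fin order → Bool
    adj-sym  : ∀ {u v} → T (adj u v) → T (adj v u)
    loopless : ∀ {v} → ¬ T (adj v v)

  Vertex : Set
  Vertex = Fin order

  infix 4 _~_
  _~_ : Vertex → Vertex → Set
  u ~ v = T (adj u v)

  open Walks _~_ public using (Connected)

  degree : Vertex → ℕ
  degree v = length (filterᵇ (adj v) (allFin order))

  Bipartite : Set
  Bipartite = ∃ λ (colour : Vertex → Bool) → ∀ {u v} → u ~ v → colour u ≢ colour v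

  -- An unordered pair of adjacent vertices is listed in increasing order.
  record Edge : Set where
    constructor mkEdge
    eta-equality
    field
      lo hi  : Vertex
      .lo<hi : lo Fin.< hi
      .lo~hi : lo ~ hi

  edge : (u v : Vertex) → .(u ~ v) → Edge
  edge u v u~v with Fin.<-cmp u v
  ... | tri< u<v _ _  = mkEdge u v u<v u~v
  ... | tri≈ _ refl _ = ⊥-elim-irr (loopless u~v)
  ... | tri> _ _ v<u  = mkEdge v u v<u (adj-sym u~v)

  _≟ᴱ_ : DecidableEquality Edge
  mkEdge u v _ _ ≟ᴱ mkEdge u′ v′ _ _ = map′
    (λ { (refl , refl) → refl }) (λ { refl → refl , refl })
    (u Fin.≟ u′ ×-dec v Fin.≟ v′)

  private
    edges-at : Vertex → Vertex → List Edge
    edges-at u v with u Fin.<? v ×-dec T? (adj u v)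
    ... | yes (u<v , u~v) = mkEdge u v u<v u~v ∷ []
    ... | no  _           = []

    ∈-edges-at : ∀ u v .(u<v : u Fin.< v) .(u~v : u ~ v) → mkEdge u v u<v u~v ∈ edges-at u v
    ∈-edges-at u v u<v u~v with u Fin.<? v ×-dec T? (adj u v)
    ... | yes _ = here refl
    ... | no ¬p = ⊥-elim-irr (¬p (u<v , u~v))

  opaque
    all-edges : Enumeration {Edge} (λ _ → ⊤)
    all-edges = enumerate _≟ᴱ_ (λ _ → yes tt)
      (concatMap (λ u → concatMap (edges-at u) (allFin order)) (allFin order))
      λ { {mkEdge u v u<v u~v} _ →
          ∈-concatMap⁺ _ (lose (∈-allFin u)
            (∈-concatMap⁺ (edges-at u) (lose (∈-allFin v) (∈-edges-at u v u<v u~v)))) }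

  E : List Edge
  E = Enumeration.list all-edges

  average : (Edge → ℝ) → ℝ
  average f = meanᴿ f E

  ‖_‖₂ : (Edge → ℝ) → ℝ
  ‖ f ‖₂ = √ sumᴿ (λ e → f e *ᴿ f e) E

record Semiregular (p q : ℕ) (G : SimpleGraph) : Set where
  open SimpleGraph G
  field
    connected : Connected
    bipartite : Bipartite
    degrees   : ∀ {u v} → u ~ v →
      (degree u ≡ suc p × degree v ≡ suc q) ⊎ (degree u ≡ suc q × degree v ≡ suc p)

module UniversalCover (G : SimpleGraph) (root : SimpleGraph.Vertex G) where
  open SimpleGraph G hiding (Connected)

  mutual
    data Path : Set where
      trivial : Path
      extend  : (x : Path) (v : Vertex) → .(end x ~ v) → .(NonBacktracking x v) → Path

    end : Path → Vertex
    end trivial          = root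
    end (extend _ v _ _) = v

    NonBacktracking : Path → Vertex → Set
    NonBacktracking trivial          v = ⊤
    NonBacktracking (extend x _ _ _) v = v ≢ end x

  infix 4 _⋖_ _~̃_

  data _⋖_ (x : Path) : Path → Set where
    one-edge : ∀ v .(a : end x ~ v) .(b : NonBacktracking x v) → x ⋖ extend x v a b

  _~̃_ : Path → Path → Set
  x ~̃ y = x ⋖ y ⊎ y ⋖ x

  open Walks _~̃_

  -- Exactly one end of an edge of the cover extends the other, so the edge
  -- {x , y} with x ⋖ y is given by x and by the last vertex of y.
  record Edge~ : Set where
    constructor mkEdge~
    eta-equality
    field
      shorter : Path
      tip     : Vertex
      .adjacent        : end shorter ~ tip
      .nonBacktracking : NonBacktracking shorter tip

  longer : Edge~ → Path
  longer (mkEdge~ x v a b) = extend x v a b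

  open Edge~ using (shorter)

  π : Path → Vertex
  π = end

  πᴱ : Edge~ → Edge
  πᴱ (mkEdge~ x v x~v _) = edge (π x) v x~v

  lift : (Edge → ℝ) → Edge~ → ℝ
  lift f e = f (πᴱ e)

  _≟ᴾ_ : DecidableEquality Path
  trivial        ≟ᴾ trivial        = yes refl
  trivial        ≟ᴾ extend _ _ _ _ = no λ ()
  extend _ _ _ _ ≟ᴾ trivial        = no λ ()
  extend x v _ _ ≟ᴾ extend y w _ _ = map′
    (λ { (refl , refl) → refl }) (λ { refl → refl , refl })
    (x ≟ᴾ y ×-dec v Fin.≟ w)

  _≟ᴱ~_ : DecidableEquality Edge~
  mkEdge~ x v _ _ ≟ᴱ~ mkEdge~ y w _ _ = map′
    (λ { (refl , refl) → refl }) (λ { refl → refl , refl })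
    (x ≟ᴾ y ×-dec v Fin.≟ w)

  private
    nonBacktracking? : ∀ x v → Dec (NonBacktracking x v)
    nonBacktracking? trivial          v = yes tt
    nonBacktracking? (extend x _ _ _) v = ¬? (v Fin.≟ end x)

    extension? : ∀ x v → Dec (end x ~ v × NonBacktracking x v)
    extension? x v = T? (adj (end x) v) ×-dec nonBacktracking? x v

    extensions-at : Path → Vertex → List Path
    extensions-at x v with extension? x v
    ... | yes (a , b) = extend x v a b ∷ []
    ... | no  _       = []

    ∈-extensions-at : ∀ x v .(a : end x ~ v) .(b : NonBacktracking x v) →
      extend x v a b ∈ extensions-at x v
    ∈-extensions-at x v a b with extension? x v
    ... | yes _ = here refl
    ... | no ¬p = ⊥-elim-irr (¬p (a , b))

    parent : Path → List Path
    parent trivial          = []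
    parent (extend x _ _ _) = x ∷ []

    _⋖?_ : ∀ x y → Dec (x ⋖ y)
    x ⋖? trivial = no λ ()
    x ⋖? extend y v a b = map′ (λ { refl → one-edge v a b }) (λ { (one-edge _ _ _) → refl }) (x ≟ᴾ y)

    neighbours : ∀ x → Enumeration (x ~̃_)
    neighbours x = enumerate _≟ᴾ_ (λ y → (x ⋖? y) ⊎-dec (y ⋖? x))
      (concatMap (extensions-at x) (allFin order) ++ parent x)
      λ { (inj₁ (one-edge v a b)) → ∈-++⁺ˡ
            (∈-concatMap⁺ (extensions-at x) (lose (∈-allFin v) (∈-extensions-at x v a b)))
        ; (inj₂ (one-edge v a b)) →
            ∈-++⁺ʳ (concatMap (extensions-at x) (allFin order)) (here refl) }

    ~̃-sym : ∀ {x y} → x ~̃ y → y ~̃ x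
    ~̃-sym (inj₁ s) = inj₂ s
    ~̃-sym (inj₂ s) = inj₁ s

    to-root : ∀ x → ∃[ n ] Walk x trivial n
    to-root trivial          = 0 , []
    to-root (extend x v a b) = let n , w = to-root x in suc n , step (inj₂ (one-edge v a b)) w

    cover-connected : Connected
    cover-connected x y =
      let m , v = to-root x
          n , w = to-root y
      in m ℕ.+ n , append v (reverse ~̃-sym w)

  open Distances _≟ᴾ_ neighbours cover-connected public using (δ; distance)

  EdgeSphere : ℕ → Path → Edge~ → Set
  EdgeSphere r v₀ e = δ (shorter e) v₀ ℕ.⊓ δ (longer e) v₀ ≡ r

  private
    open Distances _≟ᴾ_ neighbours cover-connected using (reachable; ∈-reachable)

    last-edge : Path → List Edge~
    last-edge trivial          = []
    last-edge (extend x v a b) = mkEdge~ x v a b ∷ []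

    candidates : ℕ → Path → List Edge~
    candidates r v₀ = concatMap last-edge (reachable (suc r) v₀ ++ reachable r v₀)

    ∈-candidates : ∀ r v₀ e → EdgeSphere r v₀ e → e ∈ candidates r v₀
    ∈-candidates r v₀ e@(mkEdge~ x v a b) e∈ = ∈-concatMap⁺ last-edge
      (lose (near (ℕ.⊓-sel (δ x v₀) (δ (longer e) v₀))) (here refl))
      where
      walk : ∀ y → δ y v₀ ≡ r → Walk v₀ y r
      walk y eq = reverse ~̃-sym (subst (Walk y v₀) eq (proj₁ (proj₂ (distance y v₀))))
      near : (δ x v₀ ℕ.⊓ δ (longer e) v₀ ≡ δ x v₀) ⊎
             (δ x v₀ ℕ.⊓ δ (longer e) v₀ ≡ δ (longer e) v₀) →
             longer e ∈ reachable (suc r) v₀ ++ reachable r v₀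
      near (inj₁ eq) = ∈-++⁺ˡ
        (∈-reachable (snoc (walk x (trans (sym eq) e∈)) (inj₁ (one-edge v a b))))
      near (inj₂ eq) = ∈-++⁺ʳ (reachable (suc r) v₀)
        (∈-reachable (walk (longer e) (trans (sym eq) e∈)))

  opaque
    sphere : ∀ r v₀ → Enumeration (EdgeSphere r v₀)
    sphere r v₀ = enumerate _≟ᴱ~_
      (λ e → δ (shorter e) v₀ ℕ.⊓ δ (longer e) v₀ ℕ.≟ r)
      (candidates r v₀) (λ {e} → ∈-candidates r v₀ e)

  S′ : ℕ → Path → List Edge~
  S′ r v₀ = Enumeration.list (sphere r v₀)

  M : ℕ → Path → (Edge → ℝ) → ℝ
  M r v₀ f = meanᴿ (lift f) (S′ r v₀)

{-# OPTIONS --safe #-}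
module Submission where

-- The edges of the sphere S′ r v₀ are the last edges of the non-backtracking walks
-- of length r + 1 from π v₀, so the spherical mean is obtained by iterating r times
-- the operator T that averages a function of arcs over the non-backtracking
-- continuations of an arc.  T is doubly stochastic, and at every vertex it loses a
-- multiple of the dispersion of g over the outgoing arcs in L² norm.  If T² loses
-- little, then g is nearly constant on the arcs out of each vertex, and so is T g,
-- which makes g nearly equal on the arcs out of vertices at distance 2; by
-- connectedness g is nearly constant on each of the two classes of arcs given by the
-- bipartition.  Hence T² contracts the functions of mean zero on both classes.
-- Since β only has to be smaller than 1, no spectral theory is needed, and all
-- estimates are carried out over ℚ on the terms of the Cauchy sequences.

open import Defs
open import Data.Nat.Base as ℕ using (ℕ; zero; suc; z≤n; s≤s)
import Data.Nat.Properties as ℕ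
import Data.Integer.Base as ℤ
import Data.Integer.Properties as ℤ
open import Data.Rational.Base as ℚ using (ℚ; 0ℚ; 1ℚ; ½)
import Data.Rational.Properties as ℚ
import Data.Rational.Unnormalised.Base as ℚᵘ
import Data.Rational.Unnormalised.Properties as ℚᵘ
open import Data.Rational.Solver using (module +-*-Solver)
open import Data.Product.Base using (∃-syntax; _×_; _,_; proj₁; proj₂)
open import Data.Sum.Base using (_⊎_; inj₁; inj₂; swap)
open import Data.Bool.Base using (Bool; true; false; T; not; if_then_else_)
import Data.Bool.Properties as Bool
import Data.Fin.Base as Fin
import Data.Fin.Properties as Fin
open import Data.List.Base using (List; []; _∷_; _++_; map; length; filter; filterᵇ; concatMap; allFin)
open import Data.List.Properties using (filter-all)
open import Data.List.Membership.Propositional using (_∈_; find; lose)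
open import Data.List.Membership.Propositional.Properties
  using (∈-filter⁺; ∈-filter⁻; ∈-allFin; ∈-map⁺; ∈-map⁻; ∈-concatMap⁺; ∈-concatMap⁻)
open import Data.List.Membership.Propositional.Properties.WithK using (unique∧set⇒bag)
open import Data.List.Relation.Unary.Any using (here; there)
open import Data.List.Relation.Unary.All as All using (All)
open import Data.List.Relation.Unary.AllPairs using ([]; _∷_)
open import Data.List.Relation.Unary.Unique.Propositional using (Unique)
import Data.List.Relation.Unary.Unique.Propositional.Properties as Unique
open import Data.List.Relation.Binary.Permutation.Propositional as ↭ using (_↭_)
open import Data.List.Relation.Binary.BagAndSetEquality using (∼bag⇒↭)
open import Data.Empty using (⊥-elim; ⊥-elim-irr)
open import Data.Unit.Base using (tt)
open import Function.Base using (_∘_)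
open import Function.Bundles using (mk⇔)
open import Relation.Binary.Definitions using (DecidableEquality; tri<; tri≈; tri>)
open import Relation.Nullary.Decidable using (Dec; yes; no; ¬?; from-yes)
open import Relation.Nullary.Negation using (¬_; contradiction)
open import Relation.Binary.PropositionalEquality

-- Iterating means gives the mean over the sphere only if all walks of one length carry the same
-- weight. They do, because the branching numbers along a walk alternate between p and q. The
-- bipartition is the obstacle: T exchanges the two classes of arcs, so the function that is 1 on
-- one class and -1 on the other keeps its norm forever. A function coming from edges has no such
-- component, since every edge yields one arc in each class and both class means equal the average
-- over the edges. The loss at a vertex with k + 1 neighbours carries the factor (k - 1) / k², which
-- is positive because k ≥ 2. Connectedness is used only qualitatively: each pair of vertices gets
-- some constant, and finitely many constants are added up. A bound on the L² norm bounds each value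
-- on an arc, which makes the estimate uniform in the basepoint. All constants are rationals
-- obtained from the graph before any function is given, so one inequality serves every term of the
-- Cauchy sequences.

module Mixing where

  open import Data.Rational.Base using (_+_; _-_; _*_; -_; ∣_∣; _≤_; _<_)
  open +-*-Solver using (solve; con; _:=_; _:+_; _:*_; _:-_; :-_)
  open ℚ.≤-Reasoning

  private variable
    A B : Set

  -- Order and squares in the rationals

  infix 9 _²
  _² : ℚ → ℚ
  x ² = x * x

  0≤1 : 0ℚ ≤ 1ℚ
  0≤1 = from-yes (0ℚ ℚ.≤? 1ℚ)

  2-nonNeg : 0ℚ ≤ 1ℚ + 1ℚ
  2-nonNeg = from-yes (0ℚ ℚ.≤? 1ℚ + 1ℚ)

  *-nonNeg : ∀ {x y} → 0ℚ ≤ x → 0ℚ ≤ y → 0ℚ ≤ x * y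
  *-nonNeg {x} {y} 0≤x 0≤y = ℚ.nonNegative⁻¹ (x * y)
    {{ℚ.nonNeg*nonNeg⇒nonNeg x {{ℚ.nonNegative 0≤x}} y {{ℚ.nonNegative 0≤y}}}}

  *-positive : ∀ {x y} → 0ℚ < x → 0ℚ < y → 0ℚ < x * y
  *-positive {x} {y} 0<x 0<y =
    ℚ.positive⁻¹ (x * y) {{ℚ.pos*pos⇒pos x {{ℚ.positive 0<x}} y {{ℚ.positive 0<y}}}}

  *-monoʳ : ∀ {x y z} → 0ℚ ≤ x → y ≤ z → x * y ≤ x * z
  *-monoʳ {x} 0≤x = ℚ.*-monoˡ-≤-nonNeg x {{ℚ.nonNegative 0≤x}}

  *-monoˡ : ∀ {x y z} → 0ℚ ≤ x → y ≤ z → y * x ≤ z * x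
  *-monoˡ {x} 0≤x = ℚ.*-monoʳ-≤-nonNeg x {{ℚ.nonNegative 0≤x}}

  *-cancelˡ : ∀ {x y z} → 0ℚ < x → x * y ≤ x * z → y ≤ z
  *-cancelˡ {x} 0<x = ℚ.*-cancelˡ-≤-pos x {{ℚ.positive 0<x}}

  -- Exhibiting the difference `d` turns an inequality into a polynomial identity, which the ring
  -- solver can check.
  ≤-by : ∀ {x y} d → 0ℚ ≤ d → x + d ≡ y → x ≤ y
  ≤-by {x} d 0≤d refl = subst (_≤ x + d) (ℚ.+-identityʳ x) (ℚ.+-monoʳ-≤ x 0≤d)

  ≤⇒0≤- : ∀ {x y} → x ≤ y → 0ℚ ≤ y - x
  ≤⇒0≤- {x} {y} x≤y = subst (_≤ y - x) (ℚ.+-inverseʳ x) (ℚ.+-monoˡ-≤ (- x) x≤y)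

  ²-nonNeg : ∀ x → 0ℚ ≤ x ²
  ²-nonNeg x with ℚ.≤-total 0ℚ x
  ... | inj₁ 0≤x = *-nonNeg 0≤x 0≤x
  ... | inj₂ x≤0 = subst (0ℚ ≤_) (solve 1 (λ x → (:- x) :* (:- x) := x :* x) refl x)
                     (*-nonNeg 0≤-x 0≤-x)
    where
    0≤-x : 0ℚ ≤ - x
    0≤-x = ℚ.neg-antimono-≤ x≤0

  ²-mono : ∀ {x y} → 0ℚ ≤ x → x ≤ y → x ² ≤ y ²
  ²-mono 0≤x x≤y = ℚ.≤-trans (*-monoʳ 0≤x x≤y) (*-monoˡ (ℚ.≤-trans 0≤x x≤y) x≤y)

  ²-+-≤ : ∀ x y → (x + y) ² ≤ (1ℚ + 1ℚ) * (x ² + y ²)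
  ²-+-≤ x y = ≤-by ((x - y) ²) (²-nonNeg (x - y))
    (solve 2 (λ x y → (x :+ y) :* (x :+ y) :+ (x :- y) :* (x :- y)
                   := (con 1ℚ :+ con 1ℚ) :* (x :* x :+ y :* y)) refl x y)

  ²-cancel-≤ : ∀ {x y} → 0ℚ ≤ y → x ² ≤ y ² → ∣ x ∣ ≤ y
  ²-cancel-≤ {x} {y} 0≤y x²≤y² with ∣ x ∣ ℚ.≤? y
  ... | yes p = p
  ... | no ¬p = contradiction (ℚ.<-≤-trans y²<∣x∣² (ℚ.≤-trans (ℚ.≤-reflexive ∣x∣²) x²≤y²))
                  (ℚ.<-irrefl refl)
    where
    y<∣x∣ : y < ∣ x ∣
    y<∣x∣ = ℚ.≰⇒> ¬p
    ∣x∣² : ∣ x ∣ ² ≡ x ²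
    ∣x∣² with ℚ.∣p∣≡p∨∣p∣≡-p x
    ... | inj₁ eq = cong _² eq
    ... | inj₂ eq = trans (cong _² eq) (solve 1 (λ x → (:- x) :* (:- x) := x :* x) refl x)
    y²<∣x∣² : y ² < ∣ x ∣ ²
    y²<∣x∣² = ℚ.≤-<-trans (*-monoʳ 0≤y (ℚ.<⇒≤ y<∣x∣))
      (ℚ.*-monoˡ-<-pos ∣ x ∣ {{ℚ.positive (ℚ.≤-<-trans 0≤y y<∣x∣)}} y<∣x∣)

  -- Finite sums over lists

  ∑ : List A → (A → ℚ) → ℚ
  ∑ []       φ = 0ℚ
  ∑ (x ∷ xs) φ = φ x + ∑ xs φ

  syntax ∑ xs (λ x → e) = ∑[ x ∈ xs ] e
  infixr 6.5 ∑

  -- Unary recursion, so that `fromℕ (suc n)` unfolds to `1ℚ + fromℕ n`, a form the ring solver can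
  -- work with.
  fromℕ : ℕ → ℚ
  fromℕ zero    = 0ℚ
  fromℕ (suc n) = 1ℚ + fromℕ n

  fromℕ-nonNeg : ∀ n → 0ℚ ≤ fromℕ n
  fromℕ-nonNeg zero    = ℚ.≤-refl
  fromℕ-nonNeg (suc n) = ℚ.+-mono-≤ 0≤1 (fromℕ-nonNeg n)

  1≤fromℕ-suc : ∀ n → 1ℚ ≤ fromℕ (suc n)
  1≤fromℕ-suc n = ≤-by (fromℕ n) (fromℕ-nonNeg n) refl

  fromℕ-pos : ∀ n → 0ℚ < fromℕ (suc n)
  fromℕ-pos n = ℚ.<-≤-trans (from-yes (0ℚ ℚ.<? 1ℚ)) (1≤fromℕ-suc n)

  toℚᵘ-fromℕ : ∀ n → ℚ.toℚᵘ (fromℕ n) ℚᵘ.≃ ℚᵘ.mkℚᵘ (ℤ.+ n) 0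
  toℚᵘ-fromℕ zero    = ℚᵘ.≃-refl
  toℚᵘ-fromℕ (suc n) = ℚᵘ.≃-trans (ℚ.toℚᵘ-homo-+ 1ℚ (fromℕ n))
    (ℚᵘ.≃-trans (ℚᵘ.+-congʳ ℚᵘ.1ℚᵘ (toℚᵘ-fromℕ n))
      (ℚᵘ.*≡* (cong (ℤ._* ℤ.+ 1) (cong (ℤ._+_ (ℤ.+ 1)) (ℤ.*-identityʳ (ℤ.+ n))))))

  recip-* : ∀ n → recip (suc n) * fromℕ (suc n) ≡ 1ℚ
  recip-* n = ℚ.toℚᵘ-injective (ℚᵘ.≃-trans (ℚ.toℚᵘ-homo-* (recip (suc n)) (fromℕ (suc n)))
    (ℚᵘ.≃-trans (ℚᵘ.*-cong (toℚᵘ-/ (ℤ.+ 1) n) (toℚᵘ-fromℕ (suc n)))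
      (ℚᵘ.*≡* (trans (ℤ.*-identityʳ _) (trans (ℤ.*-identityˡ (ℤ.+ suc n))
        (sym (trans (ℤ.*-identityˡ _) (ℤ.*-identityʳ (ℤ.+ suc n)))))))))

  recip-nonNeg : ∀ n → 0ℚ ≤ recip n
  recip-nonNeg zero    = ℚ.≤-refl
  recip-nonNeg (suc n) = ℚ.<⇒≤ (recip-pos n)

  ∑-cong : ∀ (xs : List A) {φ ψ : A → ℚ} → (∀ {x} → x ∈ xs → φ x ≡ ψ x) → ∑ xs φ ≡ ∑ xs ψ
  ∑-cong []       h = refl
  ∑-cong (x ∷ xs) h = cong₂ _+_ (h (here refl)) (∑-cong xs (h ∘ there))

  ∑-mono : ∀ (xs : List A) {φ ψ : A → ℚ} → (∀ {x} → x ∈ xs → φ x ≤ ψ x) → ∑ xs φ ≤ ∑ xs ψ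
  ∑-mono []       h = ℚ.≤-refl
  ∑-mono (x ∷ xs) h = ℚ.+-mono-≤ (h (here refl)) (∑-mono xs (h ∘ there))

  ∑-zero : ∀ (xs : List A) → ∑ xs (λ _ → 0ℚ) ≡ 0ℚ
  ∑-zero []       = refl
  ∑-zero (x ∷ xs) = trans (ℚ.+-identityˡ _) (∑-zero xs)

  ∑-nonNeg : ∀ (xs : List A) {φ : A → ℚ} → (∀ {x} → x ∈ xs → 0ℚ ≤ φ x) → 0ℚ ≤ ∑ xs φ
  ∑-nonNeg xs {φ} h = subst (_≤ ∑ xs φ) (∑-zero xs) (∑-mono xs h)

  ∑-≤-member : ∀ {xs : List A} {φ : A → ℚ} → (∀ {x} → x ∈ xs → 0ℚ ≤ φ x) →
    ∀ {y} → y ∈ xs → φ y ≤ ∑ xs φ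
  ∑-≤-member {xs = x ∷ xs} h (here refl) = ≤-by _ (∑-nonNeg xs (h ∘ there)) refl
  ∑-≤-member {xs = x ∷ xs} {φ} h {y} (there y∈) =
    ≤-by (φ x + (∑ xs φ - φ y))
      (ℚ.+-mono-≤ (h (here refl)) (≤⇒0≤- (∑-≤-member (h ∘ there) y∈)))
      (solve 3 (λ a b s → b :+ (a :+ (s :- b)) := a :+ s) refl (φ x) (φ y) (∑ xs φ))

  ∑-+ : ∀ (xs : List A) (φ ψ : A → ℚ) → ∑[ x ∈ xs ] (φ x + ψ x) ≡ ∑ xs φ + ∑ xs ψ
  ∑-+ []       φ ψ = refl
  ∑-+ (x ∷ xs) φ ψ = trans (cong (λ z → φ x + ψ x + z) (∑-+ xs φ ψ))
    (solve 4 (λ a b c d → a :+ b :+ (c :+ d) := a :+ c :+ (b :+ d)) refl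
      (φ x) (ψ x) (∑ xs φ) (∑ xs ψ))

  ∑-*ˡ : ∀ c (xs : List A) (φ : A → ℚ) → ∑[ x ∈ xs ] c * φ x ≡ c * ∑ xs φ
  ∑-*ˡ c []       φ = sym (ℚ.*-zeroʳ c)
  ∑-*ˡ c (x ∷ xs) φ = trans (cong (c * φ x +_) (∑-*ˡ c xs φ)) (sym (ℚ.*-distribˡ-+ c (φ x) (∑ xs φ)))

  ∑-const : ∀ c (xs : List A) → ∑[ x ∈ xs ] c ≡ fromℕ (length xs) * c
  ∑-const c []       = sym (ℚ.*-zeroˡ c)
  ∑-const c (x ∷ xs) = trans (cong (c +_) (∑-const c xs))
    (solve 2 (λ c n → c :+ n :* c := (con 1ℚ :+ n) :* c) refl c (fromℕ (length xs)))

  -- With `φ x ²` and `φ x` as the two functions this sums any quadratic polynomial in `φ x`;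
  -- expanded squares are brought to this shape, with zero coefficients where a term is missing.
  ∑-linear : ∀ a b c (xs : List A) (φ ψ : A → ℚ) →
    ∑[ x ∈ xs ] (a * φ x + b * ψ x + c) ≡ a * ∑ xs φ + b * ∑ xs ψ + fromℕ (length xs) * c
  ∑-linear a b c xs φ ψ = begin-equality
    ∑[ x ∈ xs ] (a * φ x + b * ψ x + c)
      ≡⟨ ∑-+ xs (λ x → a * φ x + b * ψ x) (λ _ → c) ⟩
    ∑[ x ∈ xs ] (a * φ x + b * ψ x) + ∑[ x ∈ xs ] c
      ≡⟨ cong₂ _+_ (∑-+ xs (λ x → a * φ x) (λ x → b * ψ x)) (∑-const c xs) ⟩
    ∑[ x ∈ xs ] a * φ x + ∑[ x ∈ xs ] b * ψ x + fromℕ (length xs) * c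
      ≡⟨ cong (_+ fromℕ (length xs) * c) (cong₂ _+_ (∑-*ˡ a xs φ) (∑-*ˡ b xs ψ)) ⟩
    a * ∑ xs φ + b * ∑ xs ψ + fromℕ (length xs) * c ∎

  ∑-swap : ∀ (xs : List A) (ys : List B) (φ : A → B → ℚ) →
    ∑[ x ∈ xs ] ∑[ y ∈ ys ] φ x y ≡ ∑[ y ∈ ys ] ∑[ x ∈ xs ] φ x y
  ∑-swap []       ys φ = sym (∑-zero ys)
  ∑-swap (x ∷ xs) ys φ = trans (cong (∑ ys (φ x) +_) (∑-swap xs ys φ))
    (sym (∑-+ ys (φ x) (λ y → ∑[ x ∈ xs ] φ x y)))

  ∑-++ : ∀ (xs ys : List A) (φ : A → ℚ) → ∑ (xs ++ ys) φ ≡ ∑ xs φ + ∑ ys φ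
  ∑-++ []       ys φ = sym (ℚ.+-identityˡ _)
  ∑-++ (x ∷ xs) ys φ = trans (cong (φ x +_) (∑-++ xs ys φ)) (sym (ℚ.+-assoc (φ x) _ _))

  ∑-map : ∀ (h : A → B) (xs : List A) (φ : B → ℚ) → ∑ (map h xs) φ ≡ ∑ xs (φ ∘ h)
  ∑-map h []       φ = refl
  ∑-map h (x ∷ xs) φ = cong (φ (h x) +_) (∑-map h xs φ)

  ∑-concatMap : ∀ (h : A → List B) (xs : List A) (φ : B → ℚ) →
    ∑ (concatMap h xs) φ ≡ ∑[ x ∈ xs ] ∑ (h x) φ
  ∑-concatMap h []       φ = refl
  ∑-concatMap h (x ∷ xs) φ = trans (∑-++ (h x) (concatMap h xs) φ)
    (cong (∑ (h x) φ +_) (∑-concatMap h xs φ))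

  ∑-↭ : ∀ {xs ys : List A} (φ : A → ℚ) → xs ↭ ys → ∑ xs φ ≡ ∑ ys φ
  ∑-↭ φ ↭.refl         = refl
  ∑-↭ φ (↭.prep x p)   = cong (φ x +_) (∑-↭ φ p)
  ∑-↭ φ (↭.swap x y p) = trans (cong (λ z → φ x + (φ y + z)) (∑-↭ φ p))
    (solve 3 (λ a b c → a :+ (b :+ c) := b :+ (a :+ c)) refl (φ x) (φ y) _)
  ∑-↭ φ (↭.trans p q)  = trans (∑-↭ φ p) (∑-↭ φ q)

  -- Lists without repetitions

  unique-concatMap : ∀ (h : A → List B) {xs} → Unique xs →
    (∀ {x} → x ∈ xs → Unique (h x)) →
    (∀ {x y z} → x ∈ xs → y ∈ xs → z ∈ h x → z ∈ h y → x ≡ y) → Unique (concatMap h xs)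
  unique-concatMap h [] _ _ = []
  unique-concatMap h {x ∷ xs} (x∉xs ∷ uniq) each disj = Unique.++⁺ (each (here refl))
    (unique-concatMap h uniq (each ∘ there) (λ x∈ y∈ → disj (there x∈) (there y∈)))
    λ (z∈ , z∈′) → let y , y∈ , z∈hy = find (∈-concatMap⁻ h {xs = xs} z∈′)
                   in All.lookup x∉xs y∈ (disj (here refl) (there y∈) z∈ z∈hy)

  unique-map : ∀ {h : A → B} {xs} →
    (∀ {x} → x ∈ xs → ∀ {y} → y ∈ xs → h x ≡ h y → x ≡ y) → Unique xs → Unique (map h xs)
  unique-map inj []             = []
  unique-map {h = h} inj (x∉xs ∷ uniq) =
    All.tabulate (λ z∈ eq → let y , y∈ , z≡hy = ∈-map⁻ h z∈
                            in All.lookup x∉xs y∈ (inj (here refl) (there y∈) (trans eq z≡hy)))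
    ∷ unique-map (λ x∈ y∈ → inj (there x∈) (there y∈)) uniq

  -- Two enumerations of one finite set are compared as sets, so the orders in which they were
  -- produced never have to be matched.
  unique⇒↭ : ∀ {xs ys : List A} → Unique xs → Unique ys →
    (∀ {x} → x ∈ xs → x ∈ ys) → (∀ {x} → x ∈ ys → x ∈ xs) → xs ↭ ys
  unique⇒↭ u v f g = ∼bag⇒↭ (unique∧set⇒bag u v (mk⇔ f g))

  ∑-filterᵇ : ∀ (P : A → Bool) (xs : List A) (φ : A → ℚ) →
    ∑ (filterᵇ P xs) φ ≡ ∑[ x ∈ xs ] (if P x then φ x else 0ℚ)
  ∑-filterᵇ P []       φ = refl
  ∑-filterᵇ P (x ∷ xs) φ with P x
  ... | true  = cong (φ x +_) (∑-filterᵇ P xs φ)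
  ... | false = trans (∑-filterᵇ P xs φ) (sym (ℚ.+-identityˡ _))

  ∑-remove : ∀ (_≟_ : DecidableEquality A) {xs u} → Unique xs → u ∈ xs → (φ : A → ℚ) →
    ∑ (filter (λ w → ¬? (w ≟ u)) xs) φ ≡ ∑ xs φ - φ u
  ∑-remove _≟_ {x ∷ xs} (x∉xs ∷ _) (here refl) φ with x ≟ x
  ... | no x≢x = contradiction refl x≢x
  ... | yes _  = trans
    (cong (λ l → ∑ l φ) (filter-all (λ w → ¬? (w ≟ x)) (All.map (λ x≢w w≡x → x≢w (sym w≡x)) x∉xs)))
    (solve 2 (λ a s → s := a :+ s :- a) refl (φ x) (∑ xs φ))
  ∑-remove _≟_ {x ∷ xs} {u} (x∉xs ∷ uniq) (there u∈xs) φ with x ≟ u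
  ... | yes refl = contradiction refl (All.lookup x∉xs u∈xs)
  ... | no  _    = trans (cong (φ x +_) (∑-remove _≟_ uniq u∈xs φ))
    (sym (ℚ.+-assoc (φ x) (∑ xs φ) (- φ u)))

  ∑-constant : ∀ (xs : List A) {φ : A → ℚ} {c} → (∀ {x} → x ∈ xs → φ x ≡ c) →
    ∑ xs φ ≡ fromℕ (length xs) * c
  ∑-constant xs {c = c} h = trans (∑-cong xs h) (∑-const c xs)

  -- Dispersion and Cauchy-Schwarz

  -- n ∑ φ² − (∑ φ)² is the sum of (φ x − φ y)² over the unordered pairs {x , y}.
  dispersion : List A → (A → ℚ) → ℚ
  dispersion xs φ = fromℕ (length xs) * (∑[ x ∈ xs ] φ x ²) - (∑ xs φ) ²

  -- The added sum runs over the new pairs, those containing `x`. Induction along this identity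
  -- yields both nonnegativity and the bound on a single difference.
  dispersion-∷ : ∀ x (xs : List A) φ →
    dispersion (x ∷ xs) φ ≡ dispersion xs φ + ∑[ y ∈ xs ] (φ x - φ y) ²
  dispersion-∷ x xs φ = sym (trans
    (cong (dispersion xs φ +_) (trans
      (∑-cong xs (λ {y} _ → solve 2 (λ a b →
        (a :- b) :* (a :- b) := con 1ℚ :* (b :* b) :+ (:- (a :+ a)) :* b :+ a :* a) refl (φ x) (φ y)))
      (∑-linear 1ℚ (- (φ x + φ x)) (φ x ²) xs (λ y → φ y ²) φ)))
    (solve 4 (λ n q s a →
      n :* q :- s :* s :+ (con 1ℚ :* q :+ (:- (a :+ a)) :* s :+ n :* (a :* a))
      := (con 1ℚ :+ n) :* (a :* a :+ q) :- (a :+ s) :* (a :+ s)) refl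
      (fromℕ (length xs)) (∑[ y ∈ xs ] φ y ²) (∑ xs φ) (φ x)))

  dispersion-nonNeg : ∀ (xs : List A) φ → 0ℚ ≤ dispersion xs φ
  dispersion-nonNeg []       φ = ℚ.≤-refl
  dispersion-nonNeg (x ∷ xs) φ = subst (0ℚ ≤_) (sym (dispersion-∷ x xs φ))
    (ℚ.+-mono-≤ (dispersion-nonNeg xs φ) (∑-nonNeg xs (λ {y} _ → ²-nonNeg (φ x - φ y))))

  ²-sym : ∀ x y → (x - y) ² ≡ (y - x) ²
  ²-sym = solve 2 (λ a b → (a :- b) :* (a :- b) := (b :- a) :* (b :- a)) refl

  difference-≤-dispersion : ∀ {xs : List A} φ {x y} → x ∈ xs → y ∈ xs →
    (φ x - φ y) ² ≤ dispersion xs φ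
  difference-≤-dispersion {xs = z ∷ xs} φ {x} {y} x∈ y∈ =
    subst ((φ x - φ y) ² ≤_) (sym (dispersion-∷ z xs φ)) (go x∈ y∈)
    where
    squares : ∀ {w} → w ∈ xs → 0ℚ ≤ (φ z - φ w) ²
    squares {w} _ = ²-nonNeg (φ z - φ w)
    from-head : ∀ {w} → w ∈ xs → (φ z - φ w) ² ≤ dispersion xs φ + ∑[ y ∈ xs ] (φ z - φ y) ²
    from-head w∈ = ℚ.≤-trans (∑-≤-member squares w∈)
      (≤-by (dispersion xs φ) (dispersion-nonNeg xs φ) (ℚ.+-comm _ (dispersion xs φ)))
    go : ∀ {x y} → x ∈ z ∷ xs → y ∈ z ∷ xs →
      (φ x - φ y) ² ≤ dispersion xs φ + ∑[ y ∈ xs ] (φ z - φ y) ²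
    go (here refl) (here refl) = subst (_≤ dispersion xs φ + ∑[ y ∈ xs ] (φ z - φ y) ²)
      (solve 1 (λ a → con 0ℚ := (a :- a) :* (a :- a)) refl (φ z))
      (ℚ.+-mono-≤ (dispersion-nonNeg xs φ) (∑-nonNeg xs squares))
    go (here refl) (there y∈)  = from-head y∈
    go {x} (there x∈) (here refl) = subst (_≤ dispersion xs φ + ∑[ y ∈ xs ] (φ z - φ y) ²)
      (²-sym (φ z) (φ x)) (from-head x∈)
    go (there x∈) (there y∈)   = ℚ.≤-trans (difference-≤-dispersion φ x∈ y∈)
      (≤-by _ (∑-nonNeg xs squares) refl)

  -- Cauchy-Schwarz against the constant 1, which is exactly nonnegativity of the dispersion.
  ²-∑-≤ : ∀ (xs : List A) {φ : A → ℚ} {M} → (∀ {x} → x ∈ xs → φ x ² ≤ M) →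
    (∑ xs φ) ² ≤ fromℕ (length xs) ² * M
  ²-∑-≤ xs {φ} {M} h = begin
    (∑ xs φ) ²                  ≤⟨ ≤-by (dispersion xs φ) (dispersion-nonNeg xs φ)
                                     (solve 2 (λ a b → a :+ (b :- a) := b) refl ((∑ xs φ) ²) _) ⟩
    n * (∑[ x ∈ xs ] φ x ²)     ≤⟨ *-monoʳ (fromℕ-nonNeg (length xs)) (∑-mono xs h) ⟩
    n * (∑[ x ∈ xs ] M)         ≡⟨ cong (n *_) (∑-const M xs) ⟩
    n * (n * M)                 ≡⟨ ℚ.*-assoc n n M ⟨
    n ² * M                     ∎
    where n = fromℕ (length xs)

  -- Distance from `a` to the mean of `φ`, multiplied by the length so that the empty list needs no
  -- exception.
  ²-average-≤ : ∀ (xs : List A) {φ : A → ℚ} {a M} → (∀ {x} → x ∈ xs → (a - φ x) ² ≤ M) →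
    (fromℕ (length xs) * a - ∑ xs φ) ² ≤ fromℕ (length xs) ² * M
  ²-average-≤ xs {φ} {a} {M} h =
    subst (λ z → z ² ≤ fromℕ (length xs) ² * M) eq (²-∑-≤ xs h)
    where
    eq : ∑[ x ∈ xs ] (a - φ x) ≡ fromℕ (length xs) * a - ∑ xs φ
    eq = trans (∑-cong xs (λ {x} _ →
           solve 2 (λ a b → a :- b := (:- con 1ℚ) :* b :+ con 0ℚ :* b :+ a) refl a (φ x)))
      (trans (∑-linear (- 1ℚ) 0ℚ a xs φ φ)
        (solve 3 (λ n a s → (:- con 1ℚ) :* s :+ con 0ℚ :* s :+ n :* a := n :* a :- s) refl
          (fromℕ (length xs)) a (∑ xs φ)))

  -- With k = length xs − 1, the two sides without the dispersion term differ by
  -- exactly (k − 1) / k² times the dispersion, and k ≥ 2.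
  ∑-leave-one-out-≤ : ∀ (xs : List A) (φ : A → ℚ) →
    length xs ≡ 0 ⊎ (∃[ j ] length xs ≡ 3 ℕ.+ j) →
    let t = recip (length xs ℕ.∸ 1) in
    ∑[ x ∈ xs ] (t * (∑ xs φ - φ x)) ² + t ² * dispersion xs φ ≤ ∑[ x ∈ xs ] φ x ²
  ∑-leave-one-out-≤ []         φ _                = ℚ.≤-refl
  ∑-leave-one-out-≤ xs@(_ ∷ _) φ (inj₂ (j , len)) = ≤-by (t ² * fromℕ j * dispersion xs φ)
    (*-nonNeg (*-nonNeg (²-nonNeg t) (fromℕ-nonNeg j)) (dispersion-nonNeg xs φ))
    (begin-equality
      ∑[ x ∈ xs ] (t * (s - φ x)) ² + t ² * dispersion xs φ + t ² * fromℕ j * dispersion xs φ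
        ≡⟨ cong (λ z → z + t ² * dispersion xs φ + t ² * fromℕ j * dispersion xs φ) (trans
             (∑-cong xs (λ {x} _ → solve 3 (λ t s x → t :* (s :- x) :* (t :* (s :- x))
               := t :* t :* (x :* x) :+ (:- (t :* t :* (s :+ s))) :* x :+ t :* t :* (s :* s))
               refl t s (φ x)))
             (∑-linear (t ²) (- (t ² * (s + s))) (t ² * s ²) xs (λ x → φ x ²) φ)) ⟩
      t ² * Q + (- (t ² * (s + s))) * s + fromℕ (length xs) * (t ² * s ²)
        + t ² * (fromℕ (length xs) * Q - s ²) + t ² * fromℕ j * (fromℕ (length xs) * Q - s ²)
        ≡⟨ cong (λ n → t ² * Q + (- (t ² * (s + s))) * s + fromℕ n * (t ² * s ²)
             + t ² * (fromℕ n * Q - s ²) + t ² * fromℕ j * (fromℕ n * Q - s ²)) len ⟩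
      _ ≡⟨ solve 4 (λ t j q s →
             let 1+_ = λ x → con 1ℚ :+ x
                 n = 1+ (1+ (1+ j)) in
             t :* t :* q :+ (:- (t :* t :* (s :+ s))) :* s :+ n :* (t :* t :* (s :* s))
             :+ t :* t :* (n :* q :- s :* s) :+ t :* t :* j :* (n :* q :- s :* s)
             := (t :* (1+ (1+ j))) :* (t :* (1+ (1+ j))) :* q) refl t (fromℕ j) Q s ⟩
      (t * fromℕ (2 ℕ.+ j)) ² * Q
        ≡⟨ cong (λ z → z ² * Q) (trans
             (cong (λ n → recip (n ℕ.∸ 1) * fromℕ (2 ℕ.+ j)) len) (recip-* (1 ℕ.+ j))) ⟩
      1ℚ ² * Q ≡⟨ ℚ.*-identityˡ Q ⟩
      Q ∎)
    where
    t = recip (length xs ℕ.∸ 1)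
    s = ∑ xs φ
    Q = ∑[ x ∈ xs ] φ x ²

  infixr 8 _^_
  _^_ : ℚ → ℕ → ℚ
  x ^ zero  = 1ℚ
  x ^ suc n = x * x ^ n

  -- Distances are kept squared to stay within ℚ; the price is a factor 2 at every chaining.
  ²-triangle : ∀ a b c K K′ L → (a - b) ² ≤ K * L → (b - c) ² ≤ K′ * L →
    (a - c) ² ≤ (1ℚ + 1ℚ) * (K + K′) * L
  ²-triangle a b c K K′ L h h′ = begin
    (a - c) ²                             ≡⟨ cong _² (solve 3 (λ a b c → a :- c := a :- b :+ (b :- c)) refl a b c) ⟩
    (a - b + (b - c)) ²                   ≤⟨ ²-+-≤ (a - b) (b - c) ⟩
    (1ℚ + 1ℚ) * ((a - b) ² + (b - c) ²)   ≤⟨ *-monoʳ 2-nonNeg (ℚ.+-mono-≤ h h′) ⟩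
    (1ℚ + 1ℚ) * (K * L + K′ * L)          ≡⟨ solve 3 (λ k k′ l → (con 1ℚ :+ con 1ℚ) :* (k :* l :+ k′ :* l)
                                               := (con 1ℚ :+ con 1ℚ) :* (k :+ k′) :* l) refl K K′ L ⟩
    (1ℚ + 1ℚ) * (K + K′) * L              ∎

  -- Means, rounded roots and terms of real sequences

  mean : (A → ℚ) → List A → ℚ
  mean φ xs = recip (length xs) * ∑ xs φ

  -- The constant 4 is crude: (a - b)² ≤ 2 (a² + b²), and each of the two squares is at most the
  -- whole sum.
  ²-deviation-≤ : ∀ (xs : List A) (φ : A → ℚ) {x} → x ∈ xs →
    (φ x - mean φ xs) ² ≤ fromℕ 4 * (∑[ y ∈ xs ] φ y ²)
  ²-deviation-≤ xs@(_ ∷ ys) φ {x} x∈ = *-cancelˡ (*-positive n-pos n-pos) (begin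
    n ² * (φ x - mean φ xs) ²           ≡⟨ solve 4 (λ n a t s → n :* n :* ((a :- t :* s) :* (a :- t :* s))
                                             := (n :* a :- t :* n :* s) :* (n :* a :- t :* n :* s)) refl
                                             n (φ x) (recip (length xs)) (∑ xs φ) ⟩
    (n * φ x - recip (length xs) * n * ∑ xs φ) ²
                                        ≡⟨ cong (λ z → (n * φ x - z * ∑ xs φ) ²) (recip-* (length ys)) ⟩
    (n * φ x - 1ℚ * ∑ xs φ) ²           ≡⟨ cong (λ z → (n * φ x - z) ²) (ℚ.*-identityˡ (∑ xs φ)) ⟩
    (n * φ x - ∑ xs φ) ²                ≤⟨ ²-average-≤ xs pairwise ⟩
    n ² * (fromℕ 4 * Q)                 ∎)
    where
    n = fromℕ (length xs)
    Q = ∑[ y ∈ xs ] φ y ²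
    n-pos : 0ℚ < n
    n-pos = fromℕ-pos (length ys)
    squares : ∀ {y} → y ∈ xs → φ y ² ≤ Q
    squares = ∑-≤-member {xs = xs} (λ {y} _ → ²-nonNeg (φ y))
    pairwise : ∀ {y} → y ∈ xs → (φ x - φ y) ² ≤ fromℕ 4 * Q
    pairwise {y} y∈ = begin
      (φ x - φ y) ²                     ≤⟨ ²-+-≤ (φ x) (- φ y) ⟩
      (1ℚ + 1ℚ) * (φ x ² + (- φ y) ²)   ≡⟨ solve 2 (λ a b → (con 1ℚ :+ con 1ℚ) :* (a :* a :+ (:- b) :* (:- b))
                                             := (con 1ℚ :+ con 1ℚ) :* (a :* a :+ b :* b)) refl (φ x) (φ y) ⟩
      (1ℚ + 1ℚ) * (φ x ² + φ y ²)       ≤⟨ *-monoʳ 2-nonNeg (ℚ.+-mono-≤ (squares x∈) (squares y∈)) ⟩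
      (1ℚ + 1ℚ) * (Q + Q)               ≡⟨ solve 1 (λ q → (con 1ℚ :+ con 1ℚ) :* (q :+ q) := con (fromℕ 4) :* q) refl Q ⟩
      fromℕ 4 * Q                       ∎

  -- Positivity of the length excludes the empty list, whose mean is 0 by convention, so that the
  -- left side would be `- μ` and the right side 0.
  mean-centred : ∀ (xs : List A) (φ : A → ℚ) μ → 0ℚ < fromℕ (length xs) →
    mean φ xs - μ ≡ recip (length xs) * (∑[ x ∈ xs ] (φ x - μ))
  mean-centred [] φ μ 0<0 = contradiction 0<0 (ℚ.<-irrefl refl)
  mean-centred xs@(_ ∷ ys) φ μ _ = sym (begin-equality
    t * (∑[ x ∈ xs ] (φ x - μ))
      ≡⟨ cong (t *_) (trans
           (∑-cong xs (λ {x} _ → solve 2 (λ a m → a :- m := con 1ℚ :* a :+ con 0ℚ :* a :+ (:- m)) refl (φ x) μ))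
           (∑-linear 1ℚ 0ℚ (- μ) xs φ φ)) ⟩
    t * (1ℚ * ∑ xs φ + 0ℚ * ∑ xs φ + n * - μ)
      ≡⟨ solve 4 (λ t n s m → t :* (con 1ℚ :* s :+ con 0ℚ :* s :+ n :* (:- m)) := t :* s :- t :* n :* m) refl
           t n (∑ xs φ) μ ⟩
    t * ∑ xs φ - t * n * μ
      ≡⟨ cong (λ z → t * ∑ xs φ - z * μ) (recip-* (length ys)) ⟩
    t * ∑ xs φ - 1ℚ * μ
      ≡⟨ cong (λ z → t * ∑ xs φ - z) (ℚ.*-identityˡ μ) ⟩
    mean φ xs - μ ∎)
    where
    t = recip (length xs)
    n = fromℕ (length xs)

  ∑-centred : ∀ (xs : List A) (φ : A → ℚ) → ∑[ x ∈ xs ] (φ x - mean φ xs) ≡ 0ℚ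
  ∑-centred []          φ = refl
  ∑-centred xs@(_ ∷ ys) φ = begin-equality
    s                  ≡⟨ ℚ.*-identityˡ s ⟨
    1ℚ * s             ≡⟨ cong (_* s) (recip-* (length ys)) ⟨
    t * n * s          ≡⟨ solve 3 (λ t n s → t :* n :* s := n :* (t :* s)) refl t n s ⟩
    n * (t * s)        ≡⟨ cong (n *_) (mean-centred xs φ (mean φ xs) (fromℕ-pos (length ys))) ⟨
    n * (mean φ xs - mean φ xs) ≡⟨ solve 2 (λ n m → n :* (m :- m) := con 0ℚ) refl n (mean φ xs) ⟩
    0ℚ                 ∎
    where
    t = recip (length xs)
    n = fromℕ (length xs)
    s = ∑[ x ∈ xs ] (φ x - mean φ xs)

  rootℚ-≤ : ∀ k {a b} → 0ℚ ≤ b → a ≤ b ² → rootℚ k a ≤ b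
  rootℚ-≤ k {a} {b} 0≤b a≤b² with rootℚ-lower k a
  ... | inj₁ eq = subst (_≤ b) (sym eq) 0≤b
  ... | inj₂ le = subst (_≤ b) (ℚ.0≤p⇒∣p∣≡p (rootℚ-nonNeg k a)) (²-cancel-≤ 0≤b (ℚ.≤-trans le a≤b²))

  recip-≤-¼ : ∀ n → 4 ℕ.≤ n → recip n ≤ ½ ²
  recip-≤-¼ (suc (suc (suc (suc k)))) (s≤s (s≤s (s≤s (s≤s z≤n)))) = *-cancelˡ {fromℕ 4} (fromℕ-pos 3) (begin
    fromℕ 4 * t          ≤⟨ *-monoˡ (recip-nonNeg n) (≤-by {fromℕ 4} {fromℕ n} (fromℕ k) (fromℕ-nonNeg k)
                              (solve 1 (λ k → con (fromℕ 4) :+ k := 1+ (1+ (1+ (1+ k)))) refl (fromℕ k))) ⟩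
    fromℕ n * t          ≡⟨ ℚ.*-comm (fromℕ n) t ⟩
    t * fromℕ n          ≡⟨ recip-* (3 ℕ.+ k) ⟩
    1ℚ                   ≡⟨⟩
    fromℕ 4 * ½ ²        ∎)
    where
    n = 4 ℕ.+ k
    t = recip n
    1+_ = λ x → con 1ℚ :+ x

  seq-sumᴿ : ∀ (f : A → ℝ) xs n → seq (sumᴿ f xs) n ≡ ∑[ x ∈ xs ] seq (f x) n
  seq-sumᴿ f []       n = refl
  seq-sumᴿ f (x ∷ xs) n = cong (seq (f x) n +_) (seq-sumᴿ f xs n)

  seq-meanᴿ : ∀ (f : A → ℝ) xs n → seq (meanᴿ f xs) n ≡ mean (λ x → seq (f x) n) xs
  seq-meanᴿ f xs n = cong (recip (length xs) *_) (seq-sumᴿ f xs n)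

  seq-^ᴿ : ∀ b r n → seq (fromℚ b ^ᴿ r) n ≡ b ^ r
  seq-^ᴿ b zero    n = refl
  seq-^ᴿ b (suc r) n = cong (b *_) (seq-^ᴿ b r n)

  ^-nonNeg : ∀ {b} → 0ℚ ≤ b → ∀ r → 0ℚ ≤ b ^ r
  ^-nonNeg 0≤b zero    = 0≤1
  ^-nonNeg 0≤b (suc r) = *-nonNeg 0≤b (^-nonNeg 0≤b r)

  ^-≤1 : ∀ {b} → 0ℚ ≤ b → b ≤ 1ℚ → ∀ r → b ^ r ≤ 1ℚ
  ^-≤1     0≤b b≤1 zero    = ℚ.≤-refl
  ^-≤1 {b} 0≤b b≤1 (suc r) = ℚ.≤-trans (*-monoʳ 0≤b (^-≤1 0≤b b≤1 r))
    (subst (_≤ 1ℚ) (sym (ℚ.*-identityʳ b)) b≤1)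

  fromℚ-<ᴿ : ∀ {a b} → a < b → fromℚ a <ᴿ fromℚ b
  fromℚ-<ᴿ {a} {b} a<b = b - a , subst (_< b - a) (ℚ.+-inverseʳ a) (ℚ.+-monoˡ-< (- a) a<b) , 0 , λ _ _ →
    ℚ.≤-reflexive (solve 2 (λ a b → a :+ (b :- a) := b) refl a b)

  -- Arcs and the non-backtracking operator

  module Arcs (G : SimpleGraph) where
    open SimpleGraph G

    vertices : List Vertex
    vertices = allFin order

    nbrs : Vertex → List Vertex
    nbrs v = filterᵇ (adj v) vertices

    ∈-nbrs⁺ : ∀ {u v} → u ~ v → v ∈ nbrs u
    ∈-nbrs⁺ {u} {v} u~v = ∈-filter⁺ (Bool.T? ∘ adj u) (∈-allFin v) u~v

    ∈-nbrs⁻ : ∀ {u v} → v ∈ nbrs u → u ~ v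
    ∈-nbrs⁻ {u} v∈ = proj₂ (∈-filter⁻ (Bool.T? ∘ adj u) {xs = vertices} v∈)

    nbrs-unique : ∀ v → Unique (nbrs v)
    nbrs-unique v = Unique.filter⁺ (Bool.T? ∘ adj v) (Unique.allFin⁺ order)

    adj-≡ : ∀ u v → adj u v ≡ adj v u
    adj-≡ u v with adj u v in p | adj v u in q
    ... | true  | true  = refl
    ... | false | false = refl
    ... | true  | false = ⊥-elim (subst T q (adj-sym (subst T (sym p) _)))
    ... | false | true  = ⊥-elim (subst T p (adj-sym (subst T (sym q) _)))

    -- Padding with zeros extends both sums to all vertices, where they can be interchanged;
    -- symmetry of `adj` then returns to neighbours.
    ∑-transpose : ∀ (φ : Vertex → Vertex → ℚ) →
      ∑[ u ∈ vertices ] ∑[ v ∈ nbrs u ] φ u v ≡ ∑[ v ∈ vertices ] ∑[ u ∈ nbrs v ] φ u v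
    ∑-transpose φ = begin-equality
      ∑[ u ∈ vertices ] ∑[ v ∈ nbrs u ] φ u v
        ≡⟨ ∑-cong vertices (λ {u} _ → ∑-filterᵇ (adj u) vertices (φ u)) ⟩
      ∑[ u ∈ vertices ] ∑[ v ∈ vertices ] (if adj u v then φ u v else 0ℚ)
        ≡⟨ ∑-swap vertices vertices _ ⟩
      ∑[ v ∈ vertices ] ∑[ u ∈ vertices ] (if adj u v then φ u v else 0ℚ)
        ≡⟨ ∑-cong vertices (λ {v} _ → ∑-cong vertices (λ {u} _ →
             cong (λ b → if b then φ u v else 0ℚ) (adj-≡ u v))) ⟩
      ∑[ v ∈ vertices ] ∑[ u ∈ vertices ] (if adj v u then φ u v else 0ℚ)
        ≡⟨ ∑-cong vertices (λ {v} _ → sym (∑-filterᵇ (adj v) vertices (λ u → φ u v))) ⟩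
      ∑[ v ∈ vertices ] ∑[ u ∈ nbrs v ] φ u v ∎

    others : Vertex → Vertex → List Vertex
    others u v = filter (λ w → ¬? (w Fin.≟ u)) (nbrs v)

    ∑-others : ∀ {u v} → u ~ v → (φ : Vertex → ℚ) → ∑ (others u v) φ ≡ ∑ (nbrs v) φ - φ u
    ∑-others {u} {v} u~v = ∑-remove Fin._≟_ (nbrs-unique v) (∈-nbrs⁺ (adj-sym u~v))

    -- A function on arcs is a function of two vertices; only its values at
    -- adjacent pairs matter.
    ArcFn : Set
    ArcFn = Vertex → Vertex → ℚ

    out : ArcFn → Vertex → ℚ
    out g v = ∑[ w ∈ nbrs v ] g v w

    -- The arcs continuing (u , v) without backtracking are all those out of v but
    -- (v , u); continueᵐ takes the mean over them.
    continue : ArcFn → ArcFn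
    continue g u v = out g v - g v u

    continueᵐ : ArcFn → ArcFn
    continueᵐ g u v = recip (degree v ℕ.∸ 1) * continue g u v

    iterate : ℕ → (ArcFn → ArcFn) → ArcFn → ArcFn
    iterate zero    Φ g = g
    iterate (suc r) Φ g = Φ (iterate r Φ g)

    energy : ArcFn → ℚ
    energy g = ∑[ u ∈ vertices ] ∑[ v ∈ nbrs u ] g u v ²

    energy-nonNeg : ∀ g → 0ℚ ≤ energy g
    energy-nonNeg g = ∑-nonNeg vertices (λ {u} _ → ∑-nonNeg (nbrs u) (λ {v} _ → ²-nonNeg (g u v)))

    -- Turns decay of the energy into decay on every single arc.
    ²-≤-energy : ∀ g {u v} → u ~ v → g u v ² ≤ energy g
    ²-≤-energy g {u} {v} u~v = ℚ.≤-trans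
      (∑-≤-member {xs = nbrs u} (λ {w} _ → ²-nonNeg (g u w)) (∈-nbrs⁺ u~v))
      (∑-≤-member (λ {u} _ → ∑-nonNeg (nbrs u) (λ {v} _ → ²-nonNeg (g u v))) (∈-allFin u))

  -- Contraction by two steps of the operator

  module Contraction
    (p q : ℕ) (2≤p : 2 ℕ.≤ p) (2≤q : 2 ℕ.≤ q)
    (G : SimpleGraph) (semiregular : Semiregular p q G)
    where

    open SimpleGraph G
    open Semiregular semiregular
    open Arcs G

    colour : Vertex → Bool
    colour = proj₁ bipartite

    colour-≢ : ∀ {u v} → u ~ v → colour u ≢ colour v
    colour-≢ = proj₂ bipartite

    -- The common bound `p + q` on the branching numbers avoids distinguishing the two degrees
    -- afterwards.
    Degree : Vertex → ℕ → Set
    Degree v k = degree v ≡ suc k × 2 ℕ.≤ k × k ℕ.≤ p ℕ.+ q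

    degree-of : ∀ {u v} → u ~ v → ∃[ k ] Degree v k
    degree-of u~v with degrees u~v
    ... | inj₁ (_ , eq) = q , eq , 2≤q , ℕ.m≤n+m q p
    ... | inj₂ (_ , eq) = p , eq , 2≤p , ℕ.m≤m+n p q

    -- Degree 0 occurs: the graph with a single vertex satisfies `Semiregular`. Otherwise p, q ≥ 2
    -- gives the three neighbours that `∑-leave-one-out-≤` asks for.
    degree-cases : ∀ v → degree v ≡ 0 ⊎ (∃[ j ] degree v ≡ 3 ℕ.+ j)
    degree-cases v with nbrs v in eq
    ... | []    = inj₁ refl
    ... | w ∷ _ with degree-of (adj-sym (∈-nbrs⁻ {v} (subst (w ∈_) (sym eq) (here refl))))
    ...   | suc (suc j) , d , s≤s (s≤s z≤n) , _ = inj₂ (j , trans (cong length (sym eq)) d)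

    branching : Vertex → ℚ
    branching v = fromℕ (degree v ℕ.∸ 1)

    recip-branching : ∀ {u v} → u ~ v → recip (degree v ℕ.∸ 1) * branching v ≡ 1ℚ
    recip-branching u~v with degree-of u~v
    ... | suc k , d , _ , _ rewrite d = recip-* k

    branching-pos : ∀ {u v} → u ~ v → 0ℚ < branching v
    branching-pos u~v with degree-of u~v
    ... | suc k , d , _ , _ rewrite d = fromℕ-pos k

    fromℕ-mono : ∀ {m n} → m ℕ.≤ n → fromℕ m ≤ fromℕ n
    fromℕ-mono {n = n} z≤n = fromℕ-nonNeg n
    fromℕ-mono (s≤s m≤n)   = ℚ.+-monoʳ-≤ 1ℚ (fromℕ-mono m≤n)

    branching-≤ : ∀ {u v} → u ~ v → branching v ≤ fromℕ (p ℕ.+ q)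
    branching-≤ u~v with degree-of u~v
    ... | k , d , _ , k≤ rewrite d = fromℕ-mono k≤

    K₀ : ℚ
    K₀ = fromℕ (p ℕ.+ q) ²

    K₀-nonNeg : 0ℚ ≤ K₀
    K₀-nonNeg = ²-nonNeg (fromℕ (p ℕ.+ q))

    loss : ArcFn → ℚ
    loss g = energy g - energy (continueᵐ g)

    -- On the arcs into `v`, `continueᵐ g` depends only on `g` on the arcs out of `v`. Collecting
    -- the energy after the step by targets therefore splits the loss into contributions of the
    -- vertices.
    lossAt : ArcFn → Vertex → ℚ
    lossAt g v = ∑[ w ∈ nbrs v ] g v w ² - ∑[ u ∈ nbrs v ] continueᵐ g u v ²

    ∑-lossAt : ∀ g → ∑ vertices (lossAt g) ≡ loss g
    ∑-lossAt g = begin-equality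
      ∑ vertices (lossAt g)
        ≡⟨ ∑-cong vertices (λ {v} _ → solve 2 (λ a b → a :- b := con 1ℚ :* a :+ (:- con 1ℚ) :* b :+ con 0ℚ) refl
            (∑[ w ∈ nbrs v ] g v w ²) (∑[ u ∈ nbrs v ] continueᵐ g u v ²)) ⟩
      _ ≡⟨ ∑-linear 1ℚ (- 1ℚ) 0ℚ vertices _ _ ⟩
      1ℚ * energy g + (- 1ℚ) * transposed + fromℕ (length vertices) * 0ℚ
        ≡⟨ solve 3 (λ a b n → con 1ℚ :* a :+ (:- con 1ℚ) :* b :+ n :* con 0ℚ := a :- b) refl
             (energy g) transposed (fromℕ (length vertices)) ⟩
      energy g - transposed
        ≡⟨ cong (λ z → energy g - z) (sym (∑-transpose (λ u v → continueᵐ g u v ²))) ⟩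
      loss g ∎
      where transposed = ∑[ v ∈ vertices ] ∑[ u ∈ nbrs v ] continueᵐ g u v ²

    dispersion-≤-lossAt : ∀ g v →
      recip (degree v ℕ.∸ 1) ² * dispersion (nbrs v) (g v) ≤ lossAt g v
    dispersion-≤-lossAt g v = ≤-by _ (≤⇒0≤- (∑-leave-one-out-≤ (nbrs v) (g v) (degree-cases v)))
      (solve 3 (λ a b c → a :+ (b :- (c :+ a)) := b :- c) refl
        (recip (degree v ℕ.∸ 1) ² * dispersion (nbrs v) (g v)) (∑[ w ∈ nbrs v ] g v w ²)
        (∑[ u ∈ nbrs v ] continueᵐ g u v ²))

    lossAt-nonNeg : ∀ g v → 0ℚ ≤ lossAt g v
    lossAt-nonNeg g v = ℚ.≤-trans
      (*-nonNeg (²-nonNeg (recip (degree v ℕ.∸ 1))) (dispersion-nonNeg (nbrs v) (g v)))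
      (dispersion-≤-lossAt g v)

    loss-nonNeg : ∀ g → 0ℚ ≤ loss g
    loss-nonNeg g = subst (0ℚ ≤_) (∑-lossAt g) (∑-nonNeg vertices (λ {v} _ → lossAt-nonNeg g v))

    lossAt-≤-loss : ∀ g v → lossAt g v ≤ loss g
    lossAt-≤-loss g v = subst (lossAt g v ≤_) (∑-lossAt g)
      (∑-≤-member (λ {v} _ → lossAt-nonNeg g v) (∈-allFin v))

    energy-decreases : ∀ g → energy (continueᵐ g) ≤ energy g
    energy-decreases g = ≤-by (loss g) (loss-nonNeg g)
      (solve 2 (λ a b → a :+ (b :- a) := b) refl (energy (continueᵐ g)) (energy g))

    -- The dispersion enters the loss with the factor 1 / k²; `K₀` undoes it, as k ≤ p + q.
    fork-close : ∀ g {v w w′} → v ~ w → v ~ w′ → (g v w - g v w′) ² ≤ K₀ * loss g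
    fork-close g {v} {w} {w′} v~w v~w′ = begin
      (g v w - g v w′) ²  ≤⟨ difference-≤-dispersion (g v) (∈-nbrs⁺ v~w) (∈-nbrs⁺ v~w′) ⟩
      D                   ≡⟨ ℚ.*-identityˡ D ⟨
      1ℚ ² * D            ≡⟨ cong (λ z → z ² * D) (recip-branching (adj-sym v~w)) ⟨
      (t * k) ² * D       ≡⟨ solve 3 (λ t k d → t :* k :* (t :* k) :* d := k :* k :* (t :* t :* d)) refl t k D ⟩
      k ² * (t ² * D)     ≤⟨ *-monoˡ (*-nonNeg (²-nonNeg t) (dispersion-nonNeg (nbrs v) (g v)))
                               (²-mono (fromℕ-nonNeg (degree v ℕ.∸ 1)) (branching-≤ (adj-sym v~w))) ⟩
      K₀ * (t ² * D)      ≤⟨ *-monoʳ K₀-nonNeg (ℚ.≤-trans (dispersion-≤-lossAt g v) (lossAt-≤-loss g v)) ⟩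
      K₀ * loss g         ∎
      where
      t = recip (degree v ℕ.∸ 1)
      k = branching v
      D = dispersion (nbrs v) (g v)

    length-others : ∀ {u v} → u ~ v → fromℕ (length (others u v)) ≡ branching v
    length-others {u} {v} u~v with degree-of u~v
    ... | k , d , _ , _ = begin-equality
      fromℕ (length (others u v))       ≡⟨ ℚ.*-identityʳ _ ⟨
      fromℕ (length (others u v)) * 1ℚ  ≡⟨ ∑-const 1ℚ (others u v) ⟨
      ∑[ w ∈ others u v ] 1ℚ            ≡⟨ ∑-others u~v (λ _ → 1ℚ) ⟩
      ∑[ w ∈ nbrs v ] 1ℚ - 1ℚ           ≡⟨ cong (_- 1ℚ) (∑-const 1ℚ (nbrs v)) ⟩
      fromℕ (degree v) * 1ℚ - 1ℚ        ≡⟨ cong (λ n → fromℕ n * 1ℚ - 1ℚ) d ⟩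
      (1ℚ + fromℕ k) * 1ℚ - 1ℚ          ≡⟨ solve 1 (λ k → (con 1ℚ :+ k) :* con 1ℚ :- con 1ℚ := k) refl (fromℕ k) ⟩
      fromℕ k                           ≡⟨ cong (λ n → fromℕ (n ℕ.∸ 1)) d ⟨
      branching v                        ∎

    -- `continueᵐ g u v` is a mean of values of `g` on arcs out of `v`, and each of them is close to
    -- `g v w` by `fork-close`.
    mean-close : ∀ g {u v w} → u ~ v → v ~ w → (g v w - continueᵐ g u v) ² ≤ K₀ * loss g
    mean-close g {u} {v} {w} u~v v~w = *-cancelˡ k²-pos (begin
      k ² * (a - t * c) ²     ≡⟨ solve 4 (λ k a t c → k :* k :* ((a :- t :* c) :* (a :- t :* c))
                                   := (k :* a :- t :* k :* c) :* (k :* a :- t :* k :* c)) refl k a t c ⟩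
      (k * a - t * k * c) ²   ≡⟨ cong (λ z → (k * a - z * c) ²) (recip-branching u~v) ⟩
      (k * a - 1ℚ * c) ²      ≡⟨ cong (λ z → (k * a - z) ²) (ℚ.*-identityˡ c) ⟩
      (k * a - c) ²           ≡⟨ cong₂ (λ k c → (k * a - c) ²) (length-others u~v) (∑-others u~v (g v)) ⟨
      (n * a - ∑ xs (g v)) ²  ≤⟨ ²-average-≤ xs (λ {w′} w′∈ → fork-close g v~w
                                   (∈-nbrs⁻ (proj₁ (∈-filter⁻ (λ w → ¬? (w Fin.≟ u)) {xs = nbrs v} w′∈)))) ⟩
      n ² * (K₀ * loss g)     ≡⟨ cong (λ n → n ² * (K₀ * loss g)) (length-others u~v) ⟩
      k ² * (K₀ * loss g)     ∎)
      where
      a = g v w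
      t = recip (degree v ℕ.∸ 1)
      c = continue g u v
      k = branching v
      xs = others u v
      n = fromℕ (length xs)
      k²-pos : 0ℚ < k ²
      k²-pos = *-positive (branching-pos u~v) (branching-pos u~v)

    -- A single step loses nothing on a function of the source alone, g u v = h u. It becomes h v,
    -- and the second step then loses the dispersion of h around each vertex.
    loss₂ : ArcFn → ℚ
    loss₂ g = energy g - energy (continueᵐ (continueᵐ g))

    loss-+ : ∀ g → loss g + loss (continueᵐ g) ≡ loss₂ g
    loss-+ g = solve 3 (λ a b c → (a :- b) :+ (b :- c) := a :- c) refl
      (energy g) (energy (continueᵐ g)) (energy (continueᵐ (continueᵐ g)))

    loss-≤-loss₂ : ∀ g → loss g ≤ loss₂ g
    loss-≤-loss₂ g = ≤-by (loss (continueᵐ g)) (loss-nonNeg (continueᵐ g)) (loss-+ g)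

    loss′-≤-loss₂ : ∀ g → loss (continueᵐ g) ≤ loss₂ g
    loss′-≤-loss₂ g = ≤-by (loss g) (loss-nonNeg g)
      (trans (ℚ.+-comm (loss (continueᵐ g)) (loss g)) (loss-+ g))

    loss₂-nonNeg : ∀ g → 0ℚ ≤ loss₂ g
    loss₂-nonNeg g = ℚ.≤-trans (loss-nonNeg g) (loss-≤-loss₂ g)

    -- `g` is quantified inside, so that `K` belongs to the graph and not to the function.
    Close : ℚ → Vertex → Vertex → Set
    Close K v v′ = ∀ g {w w′} → v ~ w → v′ ~ w′ → (g v w - g v′ w′) ² ≤ K * loss₂ g

    K₁ : ℚ
    K₁ = (1ℚ + 1ℚ) * ((1ℚ + 1ℚ) * (K₀ + K₀) + K₀)

    close-refl : ∀ v → Close K₀ v v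
    close-refl v g v~w v~w′ = ℚ.≤-trans (fork-close g v~w v~w′) (*-monoʳ K₀-nonNeg (loss-≤-loss₂ g))

    -- With T for `continueᵐ`, the chain is g(v,w), T g(u,v), T g(u,v′), g(v′,w′). The outer links
    -- are instances of `mean-close`, the middle one is a fork of T g at `u`; the two uses of
    -- `²-triangle` produce `K₁`.
    close-two-steps : ∀ {v u v′} → v ~ u → u ~ v′ → Close K₁ v v′
    close-two-steps {v} {u} {v′} v~u u~v′ g {w} {w′} v~w v′~w′ =
      ²-triangle (g v w) (continueᵐ g u v′) (g v′ w′) ((1ℚ + 1ℚ) * (K₀ + K₀)) K₀ (loss₂ g)
        (²-triangle (g v w) (continueᵐ g u v) (continueᵐ g u v′) K₀ K₀ (loss₂ g)
        (ℚ.≤-trans (mean-close g (adj-sym v~u) v~w) (*-monoʳ K₀-nonNeg (loss-≤-loss₂ g)))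
        (ℚ.≤-trans (fork-close (continueᵐ g) (adj-sym v~u) u~v′) (*-monoʳ K₀-nonNeg (loss′-≤-loss₂ g))))
        (ℚ.≤-trans (subst (_≤ K₀ * loss g) (²-sym (g v′ w′) (continueᵐ g u v′)) (mean-close g u~v′ v′~w′))
          (*-monoʳ K₀-nonNeg (loss-≤-loss₂ g)))

    open Walks _~_ using (Walk; []; step)

    ≢-≢⇒≡ : ∀ {a b c : Bool} → a ≢ b → b ≢ c → a ≡ c
    ≢-≢⇒≡ a≢b b≢c = trans (Bool.¬-not a≢b) (sym (Bool.¬-not (b≢c ∘ sym)))

    -- Two edges are removed at a time, so the colours of the ends stay equal and a single remaining
    -- edge is impossible. The constant may grow with the walk, as only finitely many pairs of
    -- vertices occur.
    close-walk : ∀ {v v′ n} → Walk v v′ n → colour v ≡ colour v′ → ∃[ K ] 0ℚ ≤ K × Close K v v′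
    close-walk {v} [] _ = K₀ , K₀-nonNeg , close-refl v
    close-walk (step v~u []) eq = contradiction eq (colour-≢ v~u)
    close-walk {v} {v′} (step {u} v~u (step {v″} u~v″ walk)) eq with close-walk walk
      (trans (sym (≢-≢⇒≡ (colour-≢ v~u) (colour-≢ u~v″))) eq)
    ... | K , 0≤K , close = (1ℚ + 1ℚ) * (K₁ + K)
      , *-nonNeg 2-nonNeg (ℚ.+-mono-≤ (*-nonNeg 2-nonNeg (ℚ.+-mono-≤ (*-nonNeg 2-nonNeg
          (ℚ.+-mono-≤ K₀-nonNeg K₀-nonNeg)) K₀-nonNeg)) 0≤K)
      -- The two comparisons are joined at the arc from `v″` back to `u`.
      , λ g {w} {w′} v~w v′~w′ → ²-triangle (g v w) (g v″ u) (g v′ w′) K₁ K (loss₂ g)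
          (close-two-steps v~u u~v″ g v~w (adj-sym u~v″))
                                   (close g (adj-sym u~v″) v′~w′)

    -- Defined for every pair, with 0 when the colours differ, so that the constants can be added
    -- up.
    closeness : ∀ v v′ → ∃[ K ] 0ℚ ≤ K × (colour v ≡ colour v′ → Close K v v′)
    closeness v v′ with colour v Bool.≟ colour v′
    ... | no  c≢c′ = 0ℚ , ℚ.≤-refl , λ eq → contradiction eq c≢c′
    ... | yes c≡c′ with close-walk (proj₂ (connected v v′)) c≡c′
    ...   | K , 0≤K , close = K , 0≤K , λ _ → close

    -- A sum of nonnegative constants in place of their maximum.
    K₂ : ℚ
    K₂ = ∑[ v ∈ vertices ] ∑[ v′ ∈ vertices ] proj₁ (closeness v v′)

    close : ∀ {v v′} → colour v ≡ colour v′ → Close K₂ v v′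
    close {v} {v′} eq g v~w v′~w′ =
      let K , _ , close-K = closeness v v′
      in ℚ.≤-trans (close-K eq g v~w v′~w′) (*-monoˡ (loss₂-nonNeg g) (ℚ.≤-trans
          (∑-≤-member {xs = vertices} (λ {v′} _ → proj₁ (proj₂ (closeness v v′))) (∈-allFin v′))
          (∑-≤-member {xs = vertices} (λ {v} _ → ∑-nonNeg vertices (λ {v′} _ → proj₁ (proj₂ (closeness v v′))))
            (∈-allFin v))))

    -- The two classes of arcs

    coloured : Bool → Vertex → Bool
    coloured true  v = colour v
    coloured false v = not (colour v)

    coloured-colour : ∀ v → T (coloured (colour v) v)
    coloured-colour v with colour v in eq
    ... | true  rewrite eq = _
    ... | false rewrite eq = _

    colour-coloured : ∀ c {v} → T (coloured c v) → colour v ≡ c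
    colour-coloured true  {v} h with colour v
    ... | true = refl
    colour-coloured false {v} h with colour v
    ... | false = refl

    coloured-flip : ∀ c {u v} → u ~ v → coloured c u ≡ coloured (not c) v
    coloured-flip true  u~v = Bool.¬-not (colour-≢ u~v)
    coloured-flip false u~v = sym (Bool.¬-not (colour-≢ u~v ∘ sym))

    arcs : Bool → List (Vertex × Vertex)
    arcs c = concatMap (λ u → map (u ,_) (nbrs u)) (filterᵇ (coloured c) vertices)

    ∈-arcs⁺ : ∀ {u v} → u ~ v → (u , v) ∈ arcs (colour u)
    ∈-arcs⁺ {u} u~v = ∈-concatMap⁺ _ (lose
      (∈-filter⁺ (Bool.T? ∘ coloured (colour u)) (∈-allFin u) (coloured-colour u))
      (∈-map⁺ (u ,_) (∈-nbrs⁺ u~v)))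

    ∈-arcs⁻ : ∀ {c u v} → (u , v) ∈ arcs c → colour u ≡ c × u ~ v
    ∈-arcs⁻ {c} uv∈ with find (∈-concatMap⁻ (λ u → map (u ,_) (nbrs u))
                            {xs = filterᵇ (coloured c) vertices} uv∈)
    ... | x , x∈ , uv∈′ with ∈-map⁻ (x ,_) uv∈′
    ...   | y , y∈ , refl = colour-coloured c (proj₂ (∈-filter⁻ (Bool.T? ∘ coloured c) {xs = vertices} x∈))
                          , ∈-nbrs⁻ y∈

    total : Bool → ArcFn → ℚ
    total c g = ∑ (arcs c) (λ (u , v) → g u v)

    Balanced : ArcFn → Set
    Balanced g = ∀ c → total c g ≡ 0ℚ

    -- Trades the list of arcs for an indicator on vertices, the form to which `∑-transpose`
    -- applies.
    total-≡ : ∀ c g → total c g ≡ ∑[ u ∈ vertices ] (if coloured c u then out g u else 0ℚ)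
    total-≡ c g = begin-equality
      ∑ (arcs c) (λ (u , v) → g u v)
        ≡⟨ ∑-concatMap _ (filterᵇ (coloured c) vertices) _ ⟩
      ∑[ u ∈ filterᵇ (coloured c) vertices ] ∑ (map (u ,_) (nbrs u)) (λ (u , v) → g u v)
        ≡⟨ ∑-cong (filterᵇ (coloured c) vertices) (λ {u} _ → ∑-map (u ,_) (nbrs u) _) ⟩
      ∑[ u ∈ filterᵇ (coloured c) vertices ] out g u
        ≡⟨ ∑-filterᵇ (coloured c) vertices (out g) ⟩
      ∑[ u ∈ vertices ] (if coloured c u then out g u else 0ℚ) ∎

    ∑-if : ∀ b (xs : List A) φ →
      (if b then ∑ xs φ else 0ℚ) ≡ ∑[ x ∈ xs ] (if b then φ x else 0ℚ)
    ∑-if true  xs φ = refl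
    ∑-if false xs φ = sym (∑-zero xs)

    -- The column sums of the operator are 1: each `g v w` is counted for the k neighbours of `v`
    -- other than `w`, with weight 1 / k.
    ∑-continueᵐ : ∀ g v → ∑[ u ∈ nbrs v ] continueᵐ g u v ≡ out g v
    ∑-continueᵐ g v = begin-equality
      ∑[ u ∈ nbrs v ] t * (s - g v u)
        ≡⟨ ∑-cong (nbrs v) (λ {u} _ → solve 3 (λ t s x → t :* (s :- x) := (:- t) :* x :+ con 0ℚ :* x :+ t :* s)
             refl t s (g v u)) ⟩
      _ ≡⟨ ∑-linear (- t) 0ℚ (t * s) (nbrs v) (g v) (g v) ⟩
      (- t) * s + 0ℚ * s + fromℕ (degree v) * (t * s)
        ≡⟨ lemma (degree-cases v) ⟩
      s ∎
      where
      t = recip (degree v ℕ.∸ 1)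
      s = out g v
      empty : ∀ (xs : List Vertex) → length xs ≡ 0 → 0ℚ ≡ ∑ xs (g v)
      empty [] _ = refl
      lemma : degree v ≡ 0 ⊎ (∃[ j ] degree v ≡ 3 ℕ.+ j) →
        (- t) * s + 0ℚ * s + fromℕ (degree v) * (t * s) ≡ s
      lemma (inj₁ d) = trans (cong (λ s → (- t) * s + 0ℚ * s + fromℕ (degree v) * (t * s))
          (sym (empty (nbrs v) d)))
        (trans (solve 2 (λ t n → (:- t) :* con 0ℚ :+ con 0ℚ :* con 0ℚ :+ n :* (t :* con 0ℚ) := con 0ℚ)
          refl t (fromℕ (degree v))) (empty (nbrs v) d))
      lemma (inj₂ (j , d)) = begin-equality
        (- t) * s + 0ℚ * s + fromℕ (degree v) * (t * s)
          ≡⟨ cong (λ n → (- t) * s + 0ℚ * s + fromℕ n * (t * s)) d ⟩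
        _ ≡⟨ solve 3 (λ t k s → (:- t) :* s :+ con 0ℚ :* s :+ (con 1ℚ :+ k) :* (t :* s) := t :* k :* s)
               refl t (fromℕ (2 ℕ.+ j)) s ⟩
        t * fromℕ (2 ℕ.+ j) * s
          ≡⟨ cong (_* s) (trans (cong (λ n → recip (n ℕ.∸ 1) * fromℕ (2 ℕ.+ j)) d) (recip-* (suc j))) ⟩
        1ℚ * s  ≡⟨ ℚ.*-identityˡ s ⟩
        s       ∎

    -- The values on arcs with source of colour `c` come from arcs one step further, whose sources
    -- have the other colour. Balance thus persists only when imposed on both classes.
    total-continueᵐ : ∀ c g → total c (continueᵐ g) ≡ total (not c) g
    total-continueᵐ c g = begin-equality
      total c (continueᵐ g)
        ≡⟨ total-≡ c (continueᵐ g) ⟩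
      ∑[ u ∈ vertices ] (if coloured c u then out (continueᵐ g) u else 0ℚ)
        ≡⟨ ∑-cong vertices (λ {u} _ → trans (∑-if (coloured c u) (nbrs u) (continueᵐ g u))
             (∑-cong (nbrs u) (λ {v} v∈ → cong (λ b → if b then continueᵐ g u v else 0ℚ)
               (coloured-flip c (∈-nbrs⁻ v∈))))) ⟩
      ∑[ u ∈ vertices ] ∑[ v ∈ nbrs u ] (if coloured (not c) v then continueᵐ g u v else 0ℚ)
        ≡⟨ ∑-transpose (λ u v → if coloured (not c) v then continueᵐ g u v else 0ℚ) ⟩
      ∑[ v ∈ vertices ] ∑[ u ∈ nbrs v ] (if coloured (not c) v then continueᵐ g u v else 0ℚ)
        ≡⟨ ∑-cong vertices (λ {v} _ → trans
             (sym (∑-if (coloured (not c) v) (nbrs v) (λ u → continueᵐ g u v)))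
             (cong (λ z → if coloured (not c) v then z else 0ℚ) (∑-continueᵐ g v))) ⟩
      ∑[ v ∈ vertices ] (if coloured (not c) v then out g v else 0ℚ)
        ≡⟨ total-≡ (not c) g ⟨
      total (not c) g ∎

    balanced-continueᵐ : ∀ {g} → Balanced g → Balanced (continueᵐ g)
    balanced-continueᵐ {g} bal c = trans (total-continueᵐ c g) (bal (not c))

    fromℕ-length-pos : ∀ {x} {xs : List A} → x ∈ xs → 0ℚ < fromℕ (length xs)
    fromℕ-length-pos {xs = _ ∷ xs} _ = fromℕ-pos (length xs)

    -- All arcs of the class of (u , v) have nearly the value `g u v`, and their mean is 0.
    balanced-≤ : ∀ {g} → Balanced g → ∀ {u v} → u ~ v → g u v ² ≤ K₂ * loss₂ g
    balanced-≤ {g} bal {u} {v} u~v = *-cancelˡ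
      (*-positive n-pos n-pos) (begin
      n ² * g u v ²                  ≡⟨ solve 2 (λ n a → n :* n :* (a :* a)
                                          := (n :* a :- con 0ℚ) :* (n :* a :- con 0ℚ)) refl n (g u v) ⟩
      (n * g u v - 0ℚ) ²             ≡⟨ cong (λ z → (n * g u v - z) ²) (bal (colour u)) ⟨
      (n * g u v - total (colour u) g) ²
        ≤⟨ ²-average-≤ (arcs (colour u)) (λ e∈ → let c≡ , u′~v′ = ∈-arcs⁻ e∈ in close (sym c≡) g u~v u′~v′) ⟩
      n ² * (K₂ * loss₂ g)           ∎)
      where
      n = fromℕ (length (arcs (colour u)))
      n-pos : 0ℚ < n
      n-pos = fromℕ-length-pos (∈-arcs⁺ u~v)

    arcCount : ℚ
    arcCount = ∑[ u ∈ vertices ] ∑[ v ∈ nbrs u ] 1ℚ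

    arcCount-nonNeg : 0ℚ ≤ arcCount
    arcCount-nonNeg = ∑-nonNeg vertices (λ {u} _ → ∑-nonNeg (nbrs u) (λ _ → 0≤1))

    energy-≤ : ∀ g {M} → (∀ {u v} → u ~ v → g u v ² ≤ M) → energy g ≤ arcCount * M
    energy-≤ g {M} h = begin
      energy g
        ≤⟨ ∑-mono vertices (λ {u} _ → ∑-mono (nbrs u) (λ v∈ → h (∈-nbrs⁻ v∈))) ⟩
      ∑[ u ∈ vertices ] ∑[ v ∈ nbrs u ] M
        ≡⟨ ∑-cong vertices (λ {u} _ → trans (∑-cong (nbrs u) (λ _ → sym (ℚ.*-identityʳ M)))
             (∑-*ˡ M (nbrs u) (λ _ → 1ℚ))) ⟩
      ∑[ u ∈ vertices ] M * (∑[ v ∈ nbrs u ] 1ℚ)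
        ≡⟨ ∑-*ˡ M vertices (λ u → ∑[ v ∈ nbrs u ] 1ℚ) ⟩
      M * arcCount ≡⟨ ℚ.*-comm M arcCount ⟩
      arcCount * M ∎

    -- The summand `1ℚ` makes `K₃` invertible and its inverse `κ` at most 1.
    K₃ : ℚ
    K₃ = 1ℚ + arcCount * K₂

    K₂-nonNeg : 0ℚ ≤ K₂
    K₂-nonNeg = ∑-nonNeg vertices (λ {v} _ → ∑-nonNeg vertices (λ {v′} _ → proj₁ (proj₂ (closeness v v′))))

    1≤K₃ : 1ℚ ≤ K₃
    1≤K₃ = ≤-by (arcCount * K₂) (*-nonNeg arcCount-nonNeg K₂-nonNeg) refl

    0<K₃ : 0ℚ < K₃
    0<K₃ = ℚ.<-≤-trans (from-yes (0ℚ ℚ.<? 1ℚ)) 1≤K₃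

    balanced-energy : ∀ {g} → Balanced g → energy g ≤ K₃ * loss₂ g
    balanced-energy {g} bal = ℚ.≤-trans (energy-≤ g (balanced-≤ bal))
      (≤-by (loss₂ g) (loss₂-nonNeg g) (solve 3 (λ n k l → n :* (k :* l) :+ l := (con 1ℚ :+ n :* k) :* l)
        refl arcCount K₂ (loss₂ g)))

    -- The rate of decay

    κ : ℚ
    κ = ℚ.1/_ K₃ {{ℚ.>-nonZero 0<K₃}}

    κ*K₃ : κ * K₃ ≡ 1ℚ
    κ*K₃ = ℚ.*-inverseˡ K₃ {{ℚ.>-nonZero 0<K₃}}

    0<κ : 0ℚ < κ
    0<κ = ℚ.positive⁻¹ κ {{ℚ.1/pos⇒pos K₃ {{ℚ.positive 0<K₃}}}}

    κ≤1 : κ ≤ 1ℚ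
    κ≤1 = subst₂ _≤_ (ℚ.*-identityʳ κ) κ*K₃ (*-monoʳ (ℚ.<⇒≤ 0<κ) 1≤K₃)

    energy-contracts : ∀ {g} → Balanced g → energy (continueᵐ (continueᵐ g)) ≤ (1ℚ - κ) * energy g
    energy-contracts {g} bal = begin
      energy (continueᵐ (continueᵐ g))
        ≡⟨ solve 2 (λ a b → b := a :- (a :- b)) refl (energy g) (energy (continueᵐ (continueᵐ g))) ⟩
      energy g - loss₂ g
        ≤⟨ ℚ.+-monoʳ-≤ (energy g) (ℚ.neg-antimono-≤ κE≤L) ⟩
      energy g - κ * energy g
        ≡⟨ solve 2 (λ e k → e :- k :* e := (con 1ℚ :- k) :* e) refl (energy g) κ ⟩
      (1ℚ - κ) * energy g ∎
      where
      κE≤L : κ * energy g ≤ loss₂ g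
      κE≤L = begin
        κ * energy g        ≤⟨ *-monoʳ (ℚ.<⇒≤ 0<κ) (balanced-energy bal) ⟩
        κ * (K₃ * loss₂ g)  ≡⟨ ℚ.*-assoc κ K₃ (loss₂ g) ⟨
        κ * K₃ * loss₂ g    ≡⟨ cong (_* loss₂ g) κ*K₃ ⟩
        1ℚ * loss₂ g        ≡⟨ ℚ.*-identityˡ (loss₂ g) ⟩
        loss₂ g             ∎

    ¼ ¾ : ℚ
    ¼ = ½ * ½
    ¾ = 1ℚ - ¼

    -- Chosen so that 1 − κ ≤ β⁴, by Bernoulli's inequality.
    β : ℚ
    β = 1ℚ - ¼ * κ

    ¾≤β : ¾ ≤ β
    ¾≤β = ℚ.+-monoʳ-≤ 1ℚ (ℚ.neg-antimono-≤ (subst (¼ * κ ≤_) (ℚ.*-identityʳ ¼)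
      (*-monoʳ (from-yes (0ℚ ℚ.≤? ¼)) κ≤1)))

    β<1 : β < 1ℚ
    β<1 = subst (β <_) (ℚ.+-identityʳ 1ℚ) (ℚ.+-monoʳ-< 1ℚ (ℚ.neg-antimono-< (*-positive (from-yes (0ℚ ℚ.<? ¼)) 0<κ)))

    -- The fourth power appears because the energy is a squared norm and the contraction takes two
    -- steps. The chain is 1 - κ ≤ (1 - κ/2)² ≤ (1 - κ/4)⁴, where squaring the second inequality
    -- uses κ/2 ≤ 1.
    1-κ≤β⁴ : 1ℚ - κ ≤ (β * β) ²
    1-κ≤β⁴ = begin
      1ℚ - κ          ≤⟨ ≤-by ((½ * κ) ²) (²-nonNeg (½ * κ)) (solve 1 (λ k →
                           con 1ℚ :- k :+ con ½ :* k :* (con ½ :* k)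
                           := (con 1ℚ :- con ½ :* k) :* (con 1ℚ :- con ½ :* k)) refl κ) ⟩
      (1ℚ - ½ * κ) ²  ≤⟨ ²-mono 0≤ (≤-by ((¼ * κ) ²) (²-nonNeg (¼ * κ)) (solve 1 (λ k →
                           con 1ℚ :- con ½ :* k :+ con ¼ :* k :* (con ¼ :* k)
                           := (con 1ℚ :- con ¼ :* k) :* (con 1ℚ :- con ¼ :* k)) refl κ)) ⟩
      (β * β) ²       ∎
      where
      0≤ : 0ℚ ≤ 1ℚ - ½ * κ
      0≤ = ≤⇒0≤- (ℚ.≤-trans (*-monoʳ (from-yes (0ℚ ℚ.≤? ½)) κ≤1) (from-yes (½ * 1ℚ ℚ.≤? 1ℚ)))

    4ℚ : ℚ
    4ℚ = fromℕ 4

    balanced-iterate : ∀ {g} → Balanced g → ∀ r → Balanced (iterate r continueᵐ g)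
    balanced-iterate bal zero    = bal
    balanced-iterate bal (suc r) = balanced-continueᵐ (balanced-iterate bal r)

    -- Induction in steps of two. The factor 4 pays for odd `r`: one step alone is only known not to
    -- increase the energy, and 1 ≤ 4 β² because β ≥ ½.
    energy-decays : ∀ {g} → Balanced g → ∀ r → energy (iterate r continueᵐ g) ≤ 4ℚ * energy g * (β ^ r) ²
    energy-decays {g} bal zero = ≤-by (fromℕ 3 * energy g) (*-nonNeg (fromℕ-nonNeg 3) (energy-nonNeg g))
      (solve 1 (λ e → e :+ con (fromℕ 3) :* e := con 4ℚ :* e :* (con 1ℚ :* con 1ℚ)) refl (energy g))
    energy-decays {g} bal (suc zero) = begin
      energy (continueᵐ g)          ≤⟨ energy-decreases g ⟩
      energy g                      ≡⟨ solve 1 (λ e → e := con 4ℚ :* e :* (con ½ :* con ½)) refl (energy g) ⟩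
      4ℚ * energy g * ½ ²           ≤⟨ *-monoʳ (*-nonNeg (fromℕ-nonNeg 4) (energy-nonNeg g))
                                         (²-mono (from-yes (0ℚ ℚ.≤? ½)) (ℚ.≤-trans (from-yes (½ ℚ.≤? ¾)) ¾≤β)) ⟩
      4ℚ * energy g * β ²           ≡⟨ cong (λ z → 4ℚ * energy g * z ²) (ℚ.*-identityʳ β) ⟨
      4ℚ * energy g * (β ^ 1) ²     ∎
    energy-decays {g} bal (suc (suc r)) = begin
      energy (iterate (2 ℕ.+ r) continueᵐ g)     ≤⟨ energy-contracts (balanced-iterate bal r) ⟩
      (1ℚ - κ) * energy (iterate r continueᵐ g)  ≤⟨ *-monoˡ (energy-nonNeg (iterate r continueᵐ g)) 1-κ≤β⁴ ⟩
      (β * β) ² * energy (iterate r continueᵐ g) ≤⟨ *-monoʳ (²-nonNeg (β * β)) (energy-decays bal r) ⟩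
      (β * β) ² * (4ℚ * energy g * (β ^ r) ²)    ≡⟨ solve 3 (λ b e x →
        b :* b :* (b :* b) :* (e :* (x :* x)) := e :* (b :* (b :* x) :* (b :* (b :* x)))) refl β (4ℚ * energy g) (β ^ r) ⟩
      4ℚ * energy g * (β ^ (2 ℕ.+ r)) ²          ∎

  -- Spheres in the universal cover

  module Spheres (G : SimpleGraph) (root : SimpleGraph.Vertex G) where
    open SimpleGraph G hiding (Connected)
    open Arcs G
    open UniversalCover G root
    open Walks _~̃_ using (Walk; []; step)
    open Edge~ using (shorter)

    infix 4 _≼_ _≼?_
    -- The order of initial segments: the paths above `x` form the branch of the tree that starts at
    -- `x`.
    data _≼_ (x : Path) : Path → Set where
      same  : x ≼ x
      above : ∀ {y v} .{a : end y ~ v} .{b : NonBacktracking y v} → x ≼ y → x ≼ extend y v a b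

    depth : Path → ℕ
    depth trivial          = 0
    depth (extend x _ _ _) = suc (depth x)

    ≼-depth : ∀ {x y} → x ≼ y → depth x ℕ.≤ depth y
    ≼-depth same      = ℕ.≤-refl
    ≼-depth (above h) = ℕ.m≤n⇒m≤1+n (≼-depth h)

    ⋖-depth : ∀ {x y} → x ⋖ y → depth y ≡ suc (depth x)
    ⋖-depth (one-edge _ _ _) = refl

    ⋖⇒⋡ : ∀ {x y} → x ⋖ y → ¬ y ≼ x
    ⋖⇒⋡ x⋖y y≼x = ℕ.<-irrefl refl (subst (ℕ._≤ _) (⋖-depth x⋖y) (≼-depth y≼x))

    _≼?_ : ∀ x y → Dec (x ≼ y)
    x ≼? trivial with x ≟ᴾ trivial
    ... | yes refl = yes same
    ... | no x≢    = no λ { same → x≢ refl }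
    x ≼? extend y v a b with x ≟ᴾ extend y v a b | x ≼? y
    ... | yes refl | _      = yes same
    ... | no _     | yes h  = yes (above h)
    ... | no x≢    | no ¬h  = no λ { same → x≢ refl ; (above h) → ¬h h }

    ⋖-≼ : ∀ {x y z} → y ⋖ z → x ≼ y → x ≼ z
    ⋖-≼ (one-edge _ _ _) h = above h

    ≼-⋖ : ∀ {x y z} → y ⋖ z → x ≼ z → x ≡ z ⊎ x ≼ y
    ≼-⋖ (one-edge _ _ _) same      = inj₁ refl
    ≼-⋖ (one-edge _ _ _) (above h) = inj₂ h

    ⋖-unique : ∀ {x y z} → x ⋖ z → y ⋖ z → x ≡ y
    ⋖-unique (one-edge _ _ _) (one-edge _ _ _) = refl

    -- A walk leaves or enters the subtree below z through the edge above z; hence an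
    -- edge y ⋖ z points toward v₀ exactly when z ≼ v₀.
    leave : ∀ {y z w t n} → y ⋖ z → z ≼ w → ¬ z ≼ t → Walk w t n → ∃[ m ] m ℕ.< n × Walk y t m
    leave y⋖z z≼w z⋠t [] = contradiction z≼w z⋠t
    leave {z = z} y⋖z z≼w z⋠t (step {w′} s walk) with z ≼? w′
    ... | yes z≼w′ = let m , m< , walk′ = leave y⋖z z≼w′ z⋠t walk in m , ℕ.m≤n⇒m≤1+n m< , walk′
    leave y⋖z z≼w z⋠t (step (inj₁ w⋖w′) walk) | no z⋠w′ = contradiction (⋖-≼ w⋖w′ z≼w) z⋠w′
    leave y⋖z z≼w z⋠t (step (inj₂ w′⋖w) walk) | no z⋠w′ with ≼-⋖ w′⋖w z≼w
    ... | inj₂ z≼w′ = contradiction z≼w′ z⋠w′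
    ... | inj₁ refl = _ , ℕ.≤-refl , subst (λ x → Walk x _ _) (⋖-unique w′⋖w y⋖z) walk

    enter : ∀ {z w t n} → ¬ z ≼ w → z ≼ t → Walk w t n → ∃[ m ] m ℕ.< n × Walk z t m
    enter z⋠w z≼t [] = contradiction z≼t z⋠w
    enter {z} z⋠w z≼t (step {w′} s walk) with z ≼? w′
    ... | no z⋠w′ = let m , m< , walk′ = enter z⋠w′ z≼t walk in m , ℕ.m≤n⇒m≤1+n m< , walk′
    enter z⋠w z≼t (step (inj₂ w′⋖w) walk) | yes z≼w′ = contradiction (⋖-≼ w′⋖w z≼w′) z⋠w
    enter z⋠w z≼t (step (inj₁ w⋖w′) walk) | yes z≼w′ with ≼-⋖ w⋖w′ z≼w′
    ... | inj₂ z≼w  = contradiction z≼w z⋠w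
    ... | inj₁ refl = _ , ℕ.≤-refl , walk

    -- Two initial segments of `t` that are one edge longer than `y` have equal length, hence
    -- coincide.
    ancestor-unique : ∀ {y x x′ t} → y ⋖ x → y ⋖ x′ → x ≼ t → x′ ≼ t → x ≡ x′
    ancestor-unique y⋖x y⋖x′ same same = refl
    ancestor-unique y⋖x y⋖x′ same x′≼x@(above _) with ≼-⋖ y⋖x x′≼x
    ... | inj₁ eq   = sym eq
    ... | inj₂ x′≼y = contradiction x′≼y (⋖⇒⋡ y⋖x′)
    ancestor-unique y⋖x y⋖x′ x≼x′@(above _) same with ≼-⋖ y⋖x′ x≼x′
    ... | inj₁ eq  = eq
    ... | inj₂ x≼y = contradiction x≼y (⋖⇒⋡ y⋖x)
    ancestor-unique y⋖x y⋖x′ (above h) (above h′) = ancestor-unique y⋖x y⋖x′ h h′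

    -- The adjacency stored in a path is irrelevant; deciding `adj` again recovers a usable proof.
    ~̃-π : ∀ {y z} → y ~̃ z → π y ~ π z
    ~̃-π {y} {z} (inj₁ (one-edge v a b)) with Bool.T? (adj (π y) v)
    ... | yes a′ = a′
    ... | no ¬a  = ⊥-elim-irr (¬a a)
    ~̃-π {y} {z} (inj₂ (one-edge v a b)) with Bool.T? (adj (π z) v)
    ... | yes a′ = adj-sym a′
    ... | no ¬a  = ⊥-elim-irr (¬a a)

    -- The neighbour of y above w; a junk value when w is not adjacent to π y.
    over : Path → Vertex → Path
    over trivial w with Bool.T? (adj root w)
    ... | yes a = extend trivial w a _
    ... | no  _ = trivial
    over y@(extend x v _ _) w with w Fin.≟ π x | Bool.T? (adj v w)
    ... | yes _   | _     = x
    ... | no w≢πx | yes a = extend y w a w≢πx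
    ... | no _    | no _  = y

    -- Together with `over-π` this is the covering property: `π` maps the neighbours of `y`
    -- bijectively onto those of `π y`.
    over-correct : ∀ y {w} → π y ~ w → y ~̃ over y w × π (over y w) ≡ w
    over-correct trivial {w} a with Bool.T? (adj root w)
    ... | yes a′ = inj₁ (one-edge w a′ _) , refl
    ... | no ¬a  = contradiction a ¬a
    over-correct (extend x v a₀ b₀) {w} a with w Fin.≟ π x | Bool.T? (adj v w)
    ... | yes eq  | _      = inj₂ (one-edge v a₀ b₀) , sym eq
    ... | no w≢πx | yes a′ = inj₁ (one-edge w a′ w≢πx) , refl
    ... | no _    | no ¬a  = contradiction a ¬a

    over-π : ∀ {y z} → y ~̃ z → over y (π z) ≡ z
    over-π {trivial} (inj₁ (one-edge v a b)) with Bool.T? (adj root v)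
    ... | yes _ = refl
    ... | no ¬a = ⊥-elim-irr (¬a a)
    over-π {extend x u _ _} (inj₁ (one-edge v a b)) with v Fin.≟ π x | Bool.T? (adj u v)
    ... | yes eq | _     = ⊥-elim-irr (b eq)
    ... | no _   | yes _ = refl
    ... | no _   | no ¬a = ⊥-elim-irr (¬a a)
    over-π {z = z} (inj₂ (one-edge v a b)) with π z Fin.≟ π z | Bool.T? (adj v (π z))
    ... | yes _ | _ = refl
    ... | no ≢  | _ = contradiction refl ≢

    -- Distance from a basepoint and arcs pointing away from it

    module From (v₀ : Path) where

      d : Path → ℕ
      d x = δ x v₀

      geodesic : ∀ x → Walk x v₀ (d x)
      geodesic x = proj₁ (proj₂ (distance x v₀))

      d-minimal : ∀ {x n} → Walk x v₀ n → d x ℕ.≤ n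
      d-minimal {x} {n} = proj₂ (proj₂ (distance x v₀)) n

      d-step : ∀ {x y} → x ~̃ y → d x ℕ.≤ suc (d y)
      d-step {y = y} s = d-minimal (step s (geodesic y))

      d-v₀ : d v₀ ≡ 0
      d-v₀ = ℕ.n≤0⇒n≡0 (d-minimal [])

      d≡0 : ∀ {x} → d x ≡ 0 → x ≡ v₀
      d≡0 {x} eq with subst (Walk x v₀) eq (geodesic x)
      ... | [] = refl

      down : ∀ {y z} → y ⋖ z → z ≼ v₀ → d y ≡ suc (d z)
      down {y} y⋖z z≼v₀ =
        let m , m< , walk = enter (⋖⇒⋡ y⋖z) z≼v₀ (geodesic y)
        in ℕ.≤-antisym (d-step (inj₁ y⋖z)) (ℕ.≤-trans (s≤s (d-minimal walk)) m<)

      up : ∀ {y z} → y ⋖ z → ¬ z ≼ v₀ → d z ≡ suc (d y)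
      up {y} {z} y⋖z z⋠v₀ =
        let m , m< , walk = leave y⋖z same z⋠v₀ (geodesic z)
        in ℕ.≤-antisym (d-step (inj₂ y⋖z)) (ℕ.≤-trans (s≤s (d-minimal walk)) m<)

      Away : Path → Path → Set
      Away x y = x ~̃ y × d y ≡ suc (d x)

      away-asym : ∀ {x y} → d y ≡ suc (d x) → ¬ d x ≡ suc (d y)
      away-asym eq eq′ = ℕ.<-asym (ℕ.≤-reflexive (sym eq)) (ℕ.≤-reflexive (sym eq′))

      away-⋖ : ∀ {y z} → y ⋖ z → Away y z ⊎ Away z y
      away-⋖ {y} {z} y⋖z with z ≼? v₀
      ... | yes z≼v₀ = inj₂ (inj₂ y⋖z , down y⋖z z≼v₀)
      ... | no  z⋠v₀ = inj₁ (inj₁ y⋖z , up y⋖z z⋠v₀)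

      away-total : ∀ {y z} → y ~̃ z → Away y z ⊎ Away z y
      away-total (inj₁ y⋖z) = away-⋖ y⋖z
      away-total (inj₂ z⋖y) = swap (away-⋖ z⋖y)

      away-⋖⇒⋠ : ∀ {y z} → y ⋖ z → d z ≡ suc (d y) → ¬ z ≼ v₀
      away-⋖⇒⋠ y⋖z eq z≼v₀ = away-asym eq (down y⋖z z≼v₀)

      toward-⋖⇒≼ : ∀ {y z} → y ⋖ z → d y ≡ suc (d z) → z ≼ v₀
      toward-⋖⇒≼ {y} {z} y⋖z eq with z ≼? v₀
      ... | yes z≼v₀ = z≼v₀
      ... | no  z⋠v₀ = contradiction (up y⋖z z⋠v₀) (away-asym eq)

      ⋖-≼⁻ : ∀ {y z t} → y ⋖ z → z ≼ t → y ≼ t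
      ⋖-≼⁻ y⋖z same        = ⋖-≼ y⋖z same
      ⋖-≼⁻ y⋖z (above z≼t) = above (⋖-≼⁻ y⋖z z≼t)

      -- Here the cover is used as a tree. Two shorter paths agree as both are the parent of `y`;
      -- two longer ones are both initial segments of `v₀`. In the mixed case the longer one lies on
      -- `v₀`, hence so does `y`, although the edge from its parent points away.
      away-unique : ∀ {x x′ y} → Away x y → Away x′ y → x ≡ x′
      away-unique (inj₁ x⋖y , _)  (inj₁ x′⋖y , _)   = ⋖-unique x⋖y x′⋖y
      away-unique (inj₁ x⋖y , eq) (inj₂ y⋖x′ , eq′) =
        contradiction (⋖-≼⁻ y⋖x′ (toward-⋖⇒≼ y⋖x′ eq′)) (away-⋖⇒⋠ x⋖y eq)
      away-unique (inj₂ y⋖x , eq) (inj₁ x′⋖y , eq′) =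
        contradiction (⋖-≼⁻ y⋖x (toward-⋖⇒≼ y⋖x eq)) (away-⋖⇒⋠ x′⋖y eq′)
      away-unique (inj₂ y⋖x , eq) (inj₂ y⋖x′ , eq′) =
        ancestor-unique y⋖x y⋖x′ (toward-⋖⇒≼ y⋖x eq) (toward-⋖⇒≼ y⋖x′ eq′)

      closer : ∀ {y r} → d y ≡ suc r → ∃[ x ] Away x y × d x ≡ r
      closer {y} {r} eq with subst (Walk y v₀) eq (geodesic y)
      ... | step {x} s walk = x , (swap s , trans eq (cong suc (sym d-x))) , d-x
        where
        d-x : d x ≡ r
        d-x = ℕ.≤-antisym (d-minimal walk) (ℕ.s≤s⁻¹ (subst (ℕ._≤ suc (d x)) eq (d-step s)))

      edge-⋖ : ∀ e → shorter e ⋖ longer e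
      edge-⋖ (mkEdge~ x v a b) = one-edge v a b

      -- The longer end is the one nearer to `v₀` exactly when it is an initial segment of `v₀`, so
      -- the result always points away from `v₀`.
      orient : Edge~ → Path × Path
      orient e with longer e ≼? v₀
      ... | yes _ = longer e , shorter e
      ... | no  _ = shorter e , longer e

      orient-away : ∀ e → let x , y = orient e in Away x y × d (shorter e) ℕ.⊓ d (longer e) ≡ d x
      orient-away e with longer e ≼? v₀
      ... | yes z≼v₀ = (inj₂ (edge-⋖ e) , eq)
                     , ℕ.m≥n⇒m⊓n≡n (ℕ.≤-trans (ℕ.n≤1+n _) (ℕ.≤-reflexive (sym eq)))
        where eq = down (edge-⋖ e) z≼v₀
      ... | no  z⋠v₀ = (inj₁ (edge-⋖ e) , eq)
                     , ℕ.m≤n⇒m⊓n≡m (ℕ.≤-trans (ℕ.n≤1+n _) (ℕ.≤-reflexive (sym eq)))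
        where eq = up (edge-⋖ e) z⋠v₀

      edge-≡ : ∀ {e e′} → shorter e ≡ shorter e′ → longer e ≡ longer e′ → e ≡ e′
      edge-≡ {mkEdge~ _ _ _ _} {mkEdge~ _ _ _ _} refl refl = refl

      orient-injective : ∀ {e e′} → orient e ≡ orient e′ → e ≡ e′
      orient-injective {e} {e′} eq with longer e ≼? v₀ | longer e′ ≼? v₀
      ... | yes _ | yes _ = edge-≡ (cong proj₂ eq) (cong proj₁ eq)
      ... | no _  | no _  = edge-≡ (cong proj₁ eq) (cong proj₂ eq)
      ... | yes h | no ¬h = contradiction (subst₂ _⋖_ (cong proj₂ eq) (cong proj₁ eq) (edge-⋖ e))
                              (λ l⋖s → ⋖⇒⋡ l⋖s (⋖-≼ (edge-⋖ e′) same))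
      ... | no ¬h | yes h = contradiction (subst₂ _⋖_ (cong proj₁ eq) (cong proj₂ eq) (edge-⋖ e))
                              (λ l⋖s → ⋖⇒⋡ l⋖s (⋖-≼ (edge-⋖ e′) same))

      orient-surjective : ∀ {x y} → Away x y → ∃[ e ] orient e ≡ (x , y)
      orient-surjective {x} {y} (inj₁ (one-edge v a b) , eq) = mkEdge~ x v a b , lemma
        where
        lemma : orient (mkEdge~ x v a b) ≡ (x , y)
        lemma with extend x v a b ≼? v₀
        ... | yes h = contradiction h (away-⋖⇒⋠ (one-edge v a b) eq)
        ... | no _  = refl
      orient-surjective {x} {y} (inj₂ (one-edge v a b) , eq) = mkEdge~ y v a b , lemma
        where
        lemma : orient (mkEdge~ y v a b) ≡ (x , y)
        lemma with extend y v a b ≼? v₀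
        ... | yes _ = refl
        ... | no ¬h = contradiction (toward-⋖⇒≼ (one-edge v a b) eq) ¬h

      -- The recursion between consecutive spheres

      shell : ℕ → List (Path × Path)
      shell r = map orient (S′ r v₀)

      shell-unique : ∀ r → Unique (shell r)
      shell-unique r = Unique.map⁺ orient-injective (Enumeration.unique (sphere r v₀))

      ∈-shell⁻ : ∀ {r x y} → (x , y) ∈ shell r → Away x y × d x ≡ r
      ∈-shell⁻ {r} xy∈ with ∈-map⁻ orient xy∈
      ... | e , e∈ , refl = let away , eq = orient-away e
                            in away , trans (sym eq) (Enumeration.sound (sphere r v₀) e∈)

      ∈-shell⁺ : ∀ {r x y} → Away x y → d x ≡ r → (x , y) ∈ shell r
      ∈-shell⁺ {r} away eq with orient-surjective away
      ... | e , refl = ∈-map⁺ orient (Enumeration.complete (sphere r v₀)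
                         (trans (proj₂ (orient-away e)) eq))

      extensions : Path × Path → List (Path × Path)
      extensions (x , y) = map (λ w → y , over y w) (others (π x) (π y))

      ∈-others⁻ : ∀ {u v w} → w ∈ others u v → v ~ w × w ≢ u
      ∈-others⁻ {u} {v} w∈ =
        let w∈nbrs , w≢u = ∈-filter⁻ (λ w → ¬? (w Fin.≟ u)) {xs = nbrs v} w∈
        in ∈-nbrs⁻ w∈nbrs , w≢u

      over-unique : ∀ y {ws} → Unique ws → (∀ {w} → w ∈ ws → π y ~ w) →
        Unique (map (λ w → y , over y w) ws)
      over-unique y uniq h = unique-map (λ {w} w∈ {w′} w′∈ eq →
        trans (sym (proj₂ (over-correct y (h w∈))))
          (trans (cong (λ e → π (proj₂ e)) eq) (proj₂ (over-correct y (h w′∈))))) uniq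

      extensions-unique : ∀ e → Unique (extensions e)
      extensions-unique (x , y) = over-unique y
        (Unique.filter⁺ (λ w → ¬? (w Fin.≟ π x)) (nbrs-unique (π y))) (λ w∈ → proj₁ (∈-others⁻ w∈))

      ∈-extensions⁻ : ∀ {x y e} → Away x y → e ∈ extensions (x , y) → proj₁ e ≡ y × Away y (proj₂ e)
      ∈-extensions⁻ {x} {y} away e∈ with ∈-map⁻ (λ w → y , over y w) e∈
      ... | w , w∈ , refl with ∈-others⁻ w∈
      ...   | πy~w , w≢πx with over-correct y πy~w
      ...     | y~z , πz≡w with away-total y~z
      ...       | inj₁ y⇒z = refl , y⇒z
      ...       | inj₂ z⇒y = contradiction (trans (sym πz≡w) (cong π (away-unique z⇒y away))) w≢πx

      -- An arc pointing away from `v₀` has a unique predecessor, starting at the neighbour of its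
      -- source nearer to `v₀`. Conversely only one neighbour of `y` lies nearer, namely `x`, and
      -- excluding `π x` below excludes `x` because `π` separates the neighbours of `y`.
      shell-suc : ∀ r → shell (suc r) ↭ concatMap extensions (shell r)
      shell-suc r = unique⇒↭ (shell-unique (suc r))
        (unique-concatMap extensions (shell-unique r) (λ {e} _ → extensions-unique e)
          λ { {x , y} {x′ , y′} e∈ e′∈ f∈ f∈′ →
              same-source (proj₁ (∈-shell⁻ e∈)) (proj₁ (∈-shell⁻ e′∈)) f∈ f∈′ })
        to from
        where
        same-source : ∀ {x y x′ y′ f} → Away x y → Away x′ y′ →
          f ∈ extensions (x , y) → f ∈ extensions (x′ , y′) → (x , y) ≡ (x′ , y′)
        same-source away away′ f∈ f∈′ with ∈-extensions⁻ away f∈ | ∈-extensions⁻ away′ f∈′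
        ... | refl , _ | refl , _ = cong (_, _) (away-unique away away′)
        to : ∀ {e} → e ∈ shell (suc r) → e ∈ concatMap extensions (shell r)
        to {y , z} e∈ with ∈-shell⁻ e∈
        ... | away@(y~z , dz) , dy with closer dy
        ...   | x , x⇒y@(x~y , _) , dx = ∈-concatMap⁺ extensions (lose (∈-shell⁺ x⇒y dx)
          (subst (_∈ extensions (x , y)) (cong (y ,_) (over-π y~z))
            (∈-map⁺ (λ w → y , over y w)
              (∈-filter⁺ (λ w → ¬? (w Fin.≟ π x)) (∈-nbrs⁺ (~̃-π y~z)) πz≢πx))))
          where
          πz≢πx : π z ≢ π x
          -- Equal projections would force z = x, and `x` is nearer to `v₀` than `y` while `z` is
          -- farther.
          πz≢πx eq = away-asym dz (subst (λ x → d y ≡ suc (d x))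
            (trans (sym (over-π (swap x~y))) (trans (cong (over y) (sym eq)) (over-π y~z)))
            (proj₂ x⇒y))
        from : ∀ {e} → e ∈ concatMap extensions (shell r) → e ∈ shell (suc r)
        from e∈ with find (∈-concatMap⁻ extensions {xs = shell r} e∈)
        ... | (x , y) , xy∈ , e∈′ with ∈-shell⁻ xy∈
        ...   | away , dx with ∈-extensions⁻ away e∈′
        ...     | refl , away′ = ∈-shell⁺ away′ (trans (proj₂ away) (cong suc dx))

      shell-zero : shell 0 ↭ map (λ w → v₀ , over v₀ w) (nbrs (π v₀))
      shell-zero = unique⇒↭ (shell-unique 0) (over-unique v₀ (nbrs-unique (π v₀)) ∈-nbrs⁻) to from
        where
        to : ∀ {e} → e ∈ shell 0 → e ∈ map (λ w → v₀ , over v₀ w) (nbrs (π v₀))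
        to {x , y} e∈ with ∈-shell⁻ e∈
        ... | (x~y , _) , dx with d≡0 dx
        ...   | refl = subst (_∈ map (λ w → v₀ , over v₀ w) (nbrs (π v₀)))
                         (cong (v₀ ,_) (over-π x~y))
                         (∈-map⁺ (λ w → v₀ , over v₀ w) (∈-nbrs⁺ (~̃-π x~y)))
        from : ∀ {e} → e ∈ map (λ w → v₀ , over v₀ w) (nbrs (π v₀)) → e ∈ shell 0
        from e∈ with ∈-map⁻ (λ w → v₀ , over v₀ w) e∈
        ... | w , w∈ , refl with over-correct v₀ (∈-nbrs⁻ w∈)
        ...   | v₀~z , _ with away-total v₀~z
        ...     | inj₁ away     = ∈-shell⁺ away d-v₀
        ...     | inj₂ (_ , eq) = contradiction (trans (sym d-v₀) eq) λ ()

      π² : ArcFn → Path × Path → ℚ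
      π² g (x , y) = g (π x) (π y)

      iterate-suc : ∀ r (Φ : ArcFn → ArcFn) g → iterate r Φ (Φ g) ≡ iterate (suc r) Φ g
      iterate-suc zero    Φ g = refl
      iterate-suc (suc r) Φ g = cong Φ (iterate-suc r Φ g)

      -- Summing over the continuations of an arc evaluates `continue g` at its projection, so each
      -- step of the recursion moves from the sphere to the function.
      ∑-shell : ∀ r g → ∑ (shell r) (π² g) ≡ out (iterate r continue g) (π v₀)
      ∑-shell zero g = begin-equality
        ∑ (shell 0) (π² g)
          ≡⟨ ∑-↭ (π² g) shell-zero ⟩
        ∑ (map (λ w → v₀ , over v₀ w) (nbrs (π v₀))) (π² g)
          ≡⟨ ∑-map (λ w → v₀ , over v₀ w) (nbrs (π v₀)) (π² g) ⟩
        ∑[ w ∈ nbrs (π v₀) ] g (π v₀) (π (over v₀ w))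
          ≡⟨ ∑-cong (nbrs (π v₀)) (λ w∈ → cong (g (π v₀)) (proj₂ (over-correct v₀ (∈-nbrs⁻ w∈)))) ⟩
        out g (π v₀) ∎
      ∑-shell (suc r) g = begin-equality
        ∑ (shell (suc r)) (π² g)
          ≡⟨ ∑-↭ (π² g) (shell-suc r) ⟩
        ∑ (concatMap extensions (shell r)) (π² g)
          ≡⟨ ∑-concatMap extensions (shell r) (π² g) ⟩
        ∑[ e ∈ shell r ] ∑ (extensions e) (π² g)
          ≡⟨ ∑-cong (shell r) (λ {e} e∈ → inner (proj₁ (∈-shell⁻ e∈))) ⟩
        ∑ (shell r) (π² (continue g))
          ≡⟨ ∑-shell r (continue g) ⟩
        out (iterate r continue (continue g)) (π v₀)
          ≡⟨ cong (λ h → out h (π v₀)) (iterate-suc r continue g) ⟩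
        out (iterate (suc r) continue g) (π v₀) ∎
        where
        inner : ∀ {x y} → Away x y → ∑ (extensions (x , y)) (π² g) ≡ continue g (π x) (π y)
        inner {x} {y} (x~y , _) = begin-equality
          ∑ (extensions (x , y)) (π² g)
            ≡⟨ ∑-map (λ w → y , over y w) (others (π x) (π y)) (π² g) ⟩
          ∑[ w ∈ others (π x) (π y) ] g (π y) (π (over y w))
            ≡⟨ ∑-cong (others (π x) (π y)) (λ w∈ →
                 cong (g (π y)) (proj₂ (over-correct y (proj₁ (∈-others⁻ w∈))))) ⟩
          ∑ (others (π x) (π y)) (g (π y))
            ≡⟨ ∑-others (~̃-π x~y) (g (π y)) ⟩
          continue g (π x) (π y) ∎

      -- Symmetry of `g` compensates for `orient` reversing the edges that lie on the way from the
      -- root to `v₀`.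
      ∑-sphere : ∀ r g → (∀ u v → g u v ≡ g v u) →
        ∑[ e ∈ S′ r v₀ ] g (π (shorter e)) (π (longer e)) ≡ out (iterate r continue g) (π v₀)
      ∑-sphere r g g-sym = trans
        (trans (∑-cong (S′ r v₀) (λ {e} _ → oriented e)) (sym (∑-map orient (S′ r v₀) (π² g))))
        (∑-shell r g)
        where
        oriented : ∀ e → g (π (shorter e)) (π (longer e)) ≡ π² g (orient e)
        oriented e with longer e ≼? v₀
        ... | yes _ = g-sym _ _
        ... | no _  = refl

  -- Functions on edges as balanced functions on arcs

  module Means
    (p q : ℕ) (2≤p : 2 ℕ.≤ p) (2≤q : 2 ℕ.≤ q)
    (G : SimpleGraph) (semiregular : Semiregular p q G)
    where

    open SimpleGraph G
    open Semiregular semiregular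
    open Arcs G
    open Contraction p q 2≤p 2≤q G semiregular
    open Edge using (lo; hi)

    edge-comm : ∀ u v (a : u ~ v) → edge u v a ≡ edge v u (adj-sym a)
    edge-comm u v a with Fin.<-cmp u v | Fin.<-cmp v u
    ... | tri< _ _ _    | tri> _ _ _    = refl
    ... | tri> _ _ _    | tri< _ _ _    = refl
    ... | tri< _ _ v≮u  | tri< v<u _ _  = contradiction v<u v≮u
    ... | tri> u≮v _ _  | tri> _ _ u<v  = contradiction u<v u≮v
    ... | tri≈ _ refl _ | _             = ⊥-elim (loopless a)
    ... | _             | tri≈ _ refl _ = ⊥-elim (loopless a)

    edge-lo-hi : ∀ e .(a : lo e ~ hi e) → edge (lo e) (hi e) a ≡ e
    edge-lo-hi (mkEdge u v u<v _) _ with Fin.<-cmp u v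
    ... | tri< _ _ _   = refl
    ... | tri≈ u≮v _ _ = ⊥-elim-irr (u≮v u<v)
    ... | tri> u≮v _ _ = ⊥-elim-irr (u≮v u<v)

    lo~hi : ∀ e → lo e ~ hi e
    lo~hi (mkEdge u v _ a) with Bool.T? (adj u v)
    ... | yes a′ = a′
    ... | no ¬a  = ⊥-elim-irr (¬a a)

    lo<hi : ∀ e → lo e Fin.< hi e
    lo<hi (mkEdge u v u<v _) with u Fin.<? v
    ... | yes u<v′ = u<v′
    ... | no ¬u<v  = ⊥-elim-irr (¬u<v u<v)

    arcFrom : Bool → Edge → Vertex × Vertex
    arcFrom c e with coloured c (lo e)
    ... | true  = lo e , hi e
    ... | false = hi e , lo e

    arcFrom-injective : ∀ c {e e′} → arcFrom c e ≡ arcFrom c e′ → e ≡ e′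
    arcFrom-injective c {e} {e′} eq with coloured c (lo e) | coloured c (lo e′)
    arcFrom-injective c refl | true  | true  = refl
    arcFrom-injective c refl | false | false = refl
    arcFrom-injective c {e} {e′} eq | true | false = contradiction (lo<hi e)
      (subst₂ (λ u v → ¬ u Fin.< v) (sym (cong proj₁ eq)) (sym (cong proj₂ eq)) (ℕ.<-asym (lo<hi e′)))
    arcFrom-injective c {e} {e′} eq | false | true = contradiction (lo<hi e)
      (subst₂ (λ u v → ¬ v Fin.< u) (sym (cong proj₁ eq)) (sym (cong proj₂ eq)) (ℕ.<-asym (lo<hi e′)))

    ∈-arcs : ∀ {c u v} → T (coloured c u) → u ~ v → (u , v) ∈ arcs c
    ∈-arcs {c} {u} {v} h u~v = subst (λ c → (u , v) ∈ arcs c) (colour-coloured c h) (∈-arcs⁺ u~v)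

    arcFrom-∈ : ∀ c e → arcFrom c e ∈ arcs c
    arcFrom-∈ c e with coloured c (lo e) in eq
    ... | true  = ∈-arcs {c} (subst T (sym eq) _) (lo~hi e)
    ... | false = ∈-arcs {c} (subst T (sym (trans (coloured-flip c (adj-sym (lo~hi e))) (flip c eq))) _)
                    (adj-sym (lo~hi e))
      where
      flip : ∀ c {u} → coloured c u ≡ false → coloured (not c) u ≡ true
      flip true  eq = cong not eq
      flip false {u} eq = trans (sym (Bool.not-involutive (colour u))) (cong not eq)

    arcFrom-edge : ∀ {u v} (a : u ~ v) → arcFrom (colour u) (edge u v a) ≡ (u , v)
    arcFrom-edge {u} {v} a with Fin.<-cmp u v
    ... | tri≈ _ refl _ = ⊥-elim (loopless a)
    ... | tri< _ _ _ with coloured (colour u) u in eq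
    ...   | true  = refl
    ...   | false = ⊥-elim (subst T eq (coloured-colour u))
    arcFrom-edge {u} {v} a | tri> _ _ _ with coloured (colour u) v in eq
    ...   | false = refl
    ...   | true  = contradiction (sym (colour-coloured (colour u) (subst T (sym eq) _))) (colour-≢ a)

    arcs-unique : ∀ c → Unique (arcs c)
    arcs-unique c = unique-concatMap (λ u → map (u ,_) (nbrs u))
      (Unique.filter⁺ (Bool.T? ∘ coloured c) (Unique.allFin⁺ order))
      (λ {u} _ → Unique.map⁺ (cong proj₂) (nbrs-unique u))
      λ {u} {u′} _ _ e∈ e∈′ → let _ , _ , eq = ∈-map⁻ (u ,_) e∈ ; _ , _ , eq′ = ∈-map⁻ (u′ ,_) e∈′
                              in trans (sym (cong proj₁ eq)) (cong proj₁ eq′)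

    ∈-E : ∀ e → e ∈ E
    ∈-E e = Enumeration.complete all-edges tt

    -- Bipartiteness: exactly one end of each edge has colour `c`.
    arcs-↭ : ∀ c → map (arcFrom c) E ↭ arcs c
    arcs-↭ c = unique⇒↭ (Unique.map⁺ (arcFrom-injective c) (Enumeration.unique all-edges))
      (arcs-unique c) to from
      where
      to : ∀ {e} → e ∈ map (arcFrom c) E → e ∈ arcs c
      to e∈ with ∈-map⁻ (arcFrom c) e∈
      ... | e , _ , refl = arcFrom-∈ c e
      from : ∀ {e} → e ∈ arcs c → e ∈ map (arcFrom c) E
      from {u , v} e∈ with ∈-arcs⁻ {c} e∈
      ... | refl , u~v = subst (_∈ map (arcFrom c) E) (arcFrom-edge u~v)
                           (∈-map⁺ (arcFrom c) (∈-E (edge u v u~v)))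

    onArcs : (Edge → ℚ) → ArcFn
    onArcs φ u v with Bool.T? (adj u v)
    ... | yes a = φ (edge u v a)
    ... | no  _ = 0ℚ

    onArcs-edge : ∀ φ {u v} (a : u ~ v) → onArcs φ u v ≡ φ (edge u v a)
    onArcs-edge φ {u} {v} a with Bool.T? (adj u v)
    ... | yes _ = refl
    ... | no ¬a = contradiction a ¬a

    onArcs-sym : ∀ φ u v → onArcs φ u v ≡ onArcs φ v u
    onArcs-sym φ u v with Bool.T? (adj u v) | Bool.T? (adj v u)
    ... | yes a | yes _ = cong φ (edge-comm u v a)
    ... | no _  | no _  = refl
    ... | yes a | no ¬a = contradiction (adj-sym a) ¬a
    ... | no ¬a | yes a = contradiction (adj-sym a) ¬a

    onArcs-lo-hi : ∀ φ e → onArcs φ (lo e) (hi e) ≡ φ e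
    onArcs-lo-hi φ e = trans (onArcs-edge φ (lo~hi e)) (cong φ (edge-lo-hi e (lo~hi e)))

    -- The total is the same for both classes, so subtracting the one mean over `E` balances both.
    total-onArcs : ∀ c φ → total c (onArcs φ) ≡ ∑ E φ
    total-onArcs c φ = begin-equality
      total c (onArcs φ)
        ≡⟨ ∑-↭ (λ (u , v) → onArcs φ u v) (arcs-↭ c) ⟨
      ∑ (map (arcFrom c) E) (λ (u , v) → onArcs φ u v)
        ≡⟨ ∑-map (arcFrom c) E (λ (u , v) → onArcs φ u v) ⟩
      ∑[ e ∈ E ] onArcs φ (proj₁ (arcFrom c e)) (proj₂ (arcFrom c e))
        ≡⟨ ∑-cong E (λ {e} _ → oriented e) ⟩
      ∑ E φ ∎
      where
      oriented : ∀ e → onArcs φ (proj₁ (arcFrom c e)) (proj₂ (arcFrom c e)) ≡ φ e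
      oriented e with coloured c (lo e)
      ... | true  = onArcs-lo-hi φ e
      ... | false = trans (onArcs-sym φ (hi e) (lo e)) (onArcs-lo-hi φ e)

    -- Sizes of spheres and normalisation

    -- The number of non-backtracking walks of length r that continue an arc into a
    -- vertex of degree a + 1 whose neighbours have degree b + 1.
    growth : ℕ → ℕ → ℕ → ℚ
    growth zero    a b = 1ℚ
    growth (suc r) a b = fromℕ a * growth r b a

    Degrees : ℕ → ℕ → Set
    Degrees a b = (a ≡ p × b ≡ q) ⊎ (a ≡ q × b ≡ p)

    Degrees-sym : ∀ {a b} → Degrees a b → Degrees b a
    Degrees-sym (inj₁ (h , h′)) = inj₂ (h′ , h)
    Degrees-sym (inj₂ (h , h′)) = inj₁ (h′ , h)

    nbr-degree : ∀ {a b v w} → Degrees a b → v ~ w → degree v ≡ suc a → degree w ≡ suc b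
    nbr-degree (inj₁ (refl , refl)) v~w dv with degrees v~w
    ... | inj₁ (_ , dw)   = dw
    ... | inj₂ (dv′ , dw) = trans dw (trans (sym dv) dv′)
    nbr-degree (inj₂ (refl , refl)) v~w dv with degrees v~w
    ... | inj₁ (dv′ , dw) = trans dw (trans (sym dv) dv′)
    ... | inj₂ (_ , dw)   = dw

    growth-pos : ∀ r {a b} → Degrees a b → 0ℚ < growth r a b
    growth-pos zero    ab = from-yes (0ℚ ℚ.<? 1ℚ)
    growth-pos (suc r) ab = *-positive (pos ab) (growth-pos r (Degrees-sym ab))
      where
      pos′ : ∀ {k} → 2 ℕ.≤ k → 0ℚ < fromℕ k
      pos′ {suc k} _ = fromℕ-pos k
      pos : ∀ {a b} → Degrees a b → 0ℚ < fromℕ a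
      pos (inj₁ (refl , _)) = pos′ 2≤p
      pos (inj₂ (refl , _)) = pos′ 2≤q

    -- The branching numbers along any walk alternate between `a` and `b`, so the normalising
    -- factors of all walks of length `r` agree and come out as one scalar.
    iterate-continue : ∀ r {a b u v} → Degrees a b → u ~ v → degree v ≡ suc a → ∀ g →
      iterate r continue g u v ≡ growth r a b * iterate r continueᵐ g u v
    iterate-continue zero ab u~v dv g = sym (ℚ.*-identityˡ _)
    iterate-continue (suc r) {a} {b} {u} {v} ab u~v dv g = begin-equality
      out h v - h v u
        ≡⟨ cong₂ _-_ (∑-cong (nbrs v) (λ w∈ → ih (∈-nbrs⁻ w∈))) (ih (adj-sym u~v)) ⟩
      ∑[ w ∈ nbrs v ] n * hᵐ v w - n * hᵐ v u
        ≡⟨ cong (_- n * hᵐ v u) (∑-*ˡ n (nbrs v) (hᵐ v)) ⟩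
      n * out hᵐ v - n * hᵐ v u
        ≡⟨ solve 3 (λ n s x → n :* s :- n :* x := con 1ℚ :* n :* (s :- x)) refl n (out hᵐ v) (hᵐ v u) ⟩
      1ℚ * n * continue hᵐ u v
        ≡⟨ cong (λ z → z * n * continue hᵐ u v) (recip-branching u~v) ⟨
      recip (degree v ℕ.∸ 1) * branching v * n * continue hᵐ u v
        ≡⟨ solve 4 (λ t k n x → t :* k :* n :* x := k :* n :* (t :* x)) refl
             (recip (degree v ℕ.∸ 1)) (branching v) n (continue hᵐ u v) ⟩
      branching v * n * continueᵐ hᵐ u v
        ≡⟨ cong (λ d → fromℕ (d ℕ.∸ 1) * n * continueᵐ hᵐ u v) dv ⟩
      fromℕ a * n * continueᵐ hᵐ u v ∎
      where
      h  = iterate r continue g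
      hᵐ = iterate r continueᵐ g
      n  = growth r b a
      ih : ∀ {w} → v ~ w → h v w ≡ n * hᵐ v w
      ih v~w = iterate-continue r (Degrees-sym ab) v~w (nbr-degree ab v~w dv) g

    iterate-continue-1 : ∀ r {a b u v} → Degrees a b → u ~ v → degree v ≡ suc a →
      iterate r continue (λ _ _ → 1ℚ) u v ≡ growth r a b
    iterate-continue-1 zero ab u~v dv = refl
    iterate-continue-1 (suc r) {a} {b} {u} {v} ab u~v dv = begin-equality
      out h v - h v u
        ≡⟨ cong₂ _-_ (∑-constant (nbrs v) (λ w∈ → ih (∈-nbrs⁻ w∈))) (ih (adj-sym u~v)) ⟩
      fromℕ (degree v) * n - n
        ≡⟨ cong (λ d → fromℕ d * n - n) dv ⟩
      (1ℚ + fromℕ a) * n - n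
        ≡⟨ solve 2 (λ a n → (con 1ℚ :+ a) :* n :- n := a :* n) refl (fromℕ a) n ⟩
      fromℕ a * n ∎
      where
      h = iterate r continue (λ _ _ → 1ℚ)
      n = growth r b a
      ih : ∀ {w} → v ~ w → h v w ≡ n
      ih v~w = iterate-continue-1 r (Degrees-sym ab) v~w (nbr-degree ab v~w dv)

    -- The factor 16 collects a 4 from energy-decays and a 4 from ²-deviation-≤; the
    -- summand 1ℚ gives 16 arcCount ≤ C².
    C : ℚ
    C = 1ℚ + fromℕ 16 * arcCount

    C-pos : 0ℚ < C
    C-pos = ℚ.+-mono-<-≤ (from-yes (0ℚ ℚ.<? 1ℚ)) (*-nonNeg (fromℕ-nonNeg 16) arcCount-nonNeg)

    -- The estimate for rational functions

    module _ (φ : Edge → ℚ) where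

      centred : ArcFn
      centred = onArcs (λ e → φ e - mean φ E)

      norm² : ℚ
      norm² = ∑[ e ∈ E ] φ e ²

      norm²-nonNeg : 0ℚ ≤ norm²
      norm²-nonNeg = ∑-nonNeg E (λ {e} _ → ²-nonNeg (φ e))

      centred-balanced : Balanced centred
      centred-balanced c = trans (total-onArcs c (λ e → φ e - mean φ E)) (∑-centred E φ)

      centred-energy : energy centred ≤ arcCount * (fromℕ 4 * norm²)
      centred-energy = energy-≤ centred (λ {u} {v} u~v → subst (λ z → z ² ≤ fromℕ 4 * norm²)
        (sym (onArcs-edge (λ e → φ e - mean φ E) u~v)) (²-deviation-≤ E φ (∈-E (edge u v u~v))))

      bound : ℕ → ℚ
      bound r = C ² * norm² * (β ^ r) ²

      bound-nonNeg : ∀ r → 0ℚ ≤ bound r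
      bound-nonNeg r = *-nonNeg (*-nonNeg (²-nonNeg C) norm²-nonNeg) (²-nonNeg (β ^ r))

      iterate-≤ : ∀ r {u v} → u ~ v → iterate r continueᵐ centred u v ² ≤ bound r
      iterate-≤ r {u} {v} u~v = begin
        iterate r continueᵐ centred u v ²
          ≤⟨ ²-≤-energy (iterate r continueᵐ centred) u~v ⟩
        energy (iterate r continueᵐ centred)
          ≤⟨ energy-decays centred-balanced r ⟩
        4ℚ * energy centred * (β ^ r) ²
          ≤⟨ *-monoˡ (²-nonNeg (β ^ r)) (begin
               4ℚ * energy centred
                 ≤⟨ *-monoʳ (fromℕ-nonNeg 4) centred-energy ⟩
               4ℚ * (arcCount * (fromℕ 4 * norm²))
                 ≤⟨ ≤-by ((1ℚ + fromℕ 16 * arcCount + 16A²) * norm²)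
                      (*-nonNeg (ℚ.+-mono-≤ (ℚ.<⇒≤ C-pos) (²-nonNeg (fromℕ 16 * arcCount))) norm²-nonNeg)
                      (solve 2 (λ a s → con (fromℕ 4) :* (a :* (con (fromℕ 4) :* s))
                          :+ (con 1ℚ :+ con (fromℕ 16) :* a
                               :+ con (fromℕ 16) :* a :* (con (fromℕ 16) :* a)) :* s
                        := (con 1ℚ :+ con (fromℕ 16) :* a) :* (con 1ℚ :+ con (fromℕ 16) :* a) :* s)
                        refl arcCount norm²) ⟩
               C ² * norm² ∎) ⟩
        bound r ∎
        where 16A² = (fromℕ 16 * arcCount) ²

      module _ (root : Vertex) where
        open UniversalCover G root
        open Edge~ using (shorter)
        open Spheres G root

        -- The centred sum over the sphere is `n` times a sum over the `d₀` arcs out of `π v₀`, and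
        -- the sphere has `d₀ * n` edges. The growth `n` cancels, and a mean of `d₀` values bounded
        -- by `iterate-≤` remains.
        deviation-≤ : ∀ r v₀ → (mean (λ e → φ (πᴱ e)) (S′ r v₀) - mean φ E) ² ≤ bound r
        deviation-≤ r v₀ with nbrs (π v₀) in nbrs≡
        -- A connected graph with an isolated vertex has no edges, and both means are 0 by the
        -- convention for empty lists.
        ... | [] = subst (λ z → z ² ≤ bound r) (sym both-zero) (bound-nonNeg r)
          where
          isolated : ∀ {w} → ¬ π v₀ ~ w
          isolated a with () ← subst (_ ∈_) nbrs≡ (∈-nbrs⁺ a)
          no-edges : ∀ e → ¬ e ∈ E
          no-edges e _ with connected (π v₀) (lo e)
          ... | _ , Walks.[]       = isolated (lo~hi e)
          ... | _ , Walks.step s _ = isolated s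
          empty : ∀ (xs : List A) {ψ : A → ℚ} → (∀ e → ¬ e ∈ xs) → mean ψ xs ≡ 0ℚ
          empty []      _ = refl
          empty (x ∷ _) h = contradiction (here refl) (h x)
          both-zero : mean (λ e → φ (πᴱ e)) (S′ r v₀) - mean φ E ≡ 0ℚ
          both-zero = cong₂ _-_ (empty (S′ r v₀) (λ e _ → no-edges (πᴱ e) (∈-E (πᴱ e)))) (empty E no-edges)
        ... | w₀ ∷ _ = go (degree-pair v₀~w₀)
          where
          open From v₀
          v₀~w₀ : π v₀ ~ w₀
          v₀~w₀ = ∈-nbrs⁻ (subst (w₀ ∈_) (sym nbrs≡) (here refl))
          degree-pair : ∀ {u v} → u ~ v → ∃[ a ] ∃[ b ] Degrees a b × degree u ≡ suc b
          degree-pair u~v with degrees u~v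
          ... | inj₁ (du , _) = q , p , inj₂ (refl , refl) , du
          ... | inj₂ (du , _) = p , q , inj₁ (refl , refl) , du
          xs = S′ r v₀
          t = recip (length xs)
          go : ∃[ a ] ∃[ b ] Degrees a b × degree (π v₀) ≡ suc b →
            (mean (λ e → φ (πᴱ e)) xs - mean φ E) ² ≤ bound r
          go (a , b , ab , dv₀) = begin
            (mean (λ e → φ (πᴱ e)) xs - mean φ E) ²
              ≡⟨ cong _² (mean-centred xs (λ e → φ (πᴱ e)) (mean φ E) size-pos) ⟩
            (t * (∑[ e ∈ xs ] (φ (πᴱ e) - mean φ E))) ²
              ≡⟨ cong (λ z → (t * z) ²) sum≡ ⟩
            (t * (n * out hᵐ (π v₀))) ²
              ≡⟨ solve 3 (λ t n s → t :* (n :* s) :* (t :* (n :* s)) := t :* n :* (t :* n) :* (s :* s)) refl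
                   t n (out hᵐ (π v₀)) ⟩
            (t * n) ² * out hᵐ (π v₀) ²
              ≤⟨ *-monoʳ (²-nonNeg (t * n)) (²-∑-≤ (nbrs (π v₀)) (λ w∈ → iterate-≤ r (∈-nbrs⁻ w∈))) ⟩
            (t * n) ² * (d₀ ² * bound r)
              ≡⟨ solve 4 (λ t n d x → t :* n :* (t :* n) :* (d :* d :* x)
                   := t :* (d :* n) :* (t :* (d :* n)) :* x) refl t n d₀ (bound r) ⟩
            (t * (d₀ * n)) ² * bound r
              ≡⟨ cong (λ z → (t * z) ² * bound r) size≡ ⟨
            (t * fromℕ (length xs)) ² * bound r
              ≡⟨ cong (λ z → z ² * bound r) (recip-length xs size-pos) ⟩
            1ℚ ² * bound r
              ≡⟨ ℚ.*-identityˡ (bound r) ⟩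
            bound r ∎
            where
            n  = growth r a b
            hᵐ = iterate r continueᵐ centred
            d₀ = fromℕ (degree (π v₀))
            recip-length : ∀ (xs : List A) → 0ℚ < fromℕ (length xs) →
              recip (length xs) * fromℕ (length xs) ≡ 1ℚ
            recip-length []       0<0 = contradiction 0<0 (ℚ.<-irrefl refl)
            recip-length (_ ∷ xs) _   = recip-* (length xs)
            nbr-deg : ∀ {w} → w ∈ nbrs (π v₀) → degree w ≡ suc a
            nbr-deg w∈ = nbr-degree (Degrees-sym ab) (∈-nbrs⁻ w∈) dv₀
            size≡ : fromℕ (length xs) ≡ d₀ * n
            size≡ = begin-equality
              fromℕ (length xs)       ≡⟨ ℚ.*-identityʳ _ ⟨
              fromℕ (length xs) * 1ℚ  ≡⟨ ∑-const 1ℚ xs ⟨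
              ∑[ e ∈ xs ] 1ℚ          ≡⟨ ∑-sphere r (λ _ _ → 1ℚ) (λ _ _ → refl) ⟩
              out (iterate r continue (λ _ _ → 1ℚ)) (π v₀)
                ≡⟨ ∑-constant (nbrs (π v₀)) (λ w∈ → iterate-continue-1 r ab (∈-nbrs⁻ w∈) (nbr-deg w∈)) ⟩
              d₀ * n                  ∎
            size-pos : 0ℚ < fromℕ (length xs)
            size-pos = subst (0ℚ <_) (sym size≡)
              (*-positive (subst (λ d → 0ℚ < fromℕ d) (sym dv₀) (fromℕ-pos b)) (growth-pos r ab))
            sum≡ : ∑[ e ∈ xs ] (φ (πᴱ e) - mean φ E) ≡ n * out hᵐ (π v₀)
            sum≡ = begin-equality
              ∑[ e ∈ xs ] (φ (πᴱ e) - mean φ E)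
                ≡⟨ ∑-cong xs (λ {e} _ → sym (onArcs-edge (λ e → φ e - mean φ E) (~̃-π (inj₁ (edge-⋖ e))))) ⟩
              ∑[ e ∈ xs ] centred (π (shorter e)) (π (longer e))
                ≡⟨ ∑-sphere r centred (onArcs-sym (λ e → φ e - mean φ E)) ⟩
              out (iterate r continue centred) (π v₀)
                ≡⟨ ∑-cong (nbrs (π v₀)) (λ w∈ → iterate-continue r ab (∈-nbrs⁻ w∈) (nbr-deg w∈) centred) ⟩
              ∑[ w ∈ nbrs (π v₀) ] n * hᵐ (π v₀) w
                ≡⟨ ∑-*ˡ n (nbrs (π v₀)) (hᵐ (π v₀)) ⟩
              n * out hᵐ (π v₀) ∎

    -- Passage to the reals

    0≤β : 0ℚ ≤ β
    0≤β = ℚ.≤-trans (from-yes (0ℚ ℚ.≤? ¾)) ¾≤β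
    -- From pq ≥ 4 the inner root is at most ½, and ½ ≤ (¾)² bounds the outer one by ¾ ≤ β.
    β-large : √ √ fromℚ (recip (p ℕ.* q)) ≤ᴿ fromℚ β
    β-large ε 0<ε = 0 , λ n _ → begin
      rootℚ n (rootℚ n (recip (p ℕ.* q)))
        ≤⟨ rootℚ-≤ n (from-yes (0ℚ ℚ.≤? ¾)) (ℚ.≤-trans
             (rootℚ-≤ n (from-yes (0ℚ ℚ.≤? ½)) (recip-≤-¼ (p ℕ.* q) (ℕ.*-mono-≤ 2≤p 2≤q)))
             (from-yes (½ ℚ.≤? ¾ ²))) ⟩
      ¾       ≤⟨ ¾≤β ⟩
      β       ≤⟨ ≤-by ε (ℚ.<⇒≤ 0<ε) refl ⟩
      β + ε   ∎
    -- The terms at index `n` satisfy `deviation-≤` with constants independent of `n`. The only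
    -- error comes from rounding the norm down by at most `t`, and it is absorbed by ε.
    estimate : ∀ root → let open UniversalCover G root in ∀ (f : Edge → ℝ) v₀ r →
      ∣ M r v₀ f -ᴿ average f ∣ᴿ ≤ᴿ fromℚ C *ᴿ ‖ f ‖₂ *ᴿ fromℚ β ^ᴿ r
    estimate root f v₀ r ε 0<ε = N , λ n N≤n →
      let φ e = seq (f e) n
          a   = seq (sumᴿ (λ e → f e *ᴿ f e) E) n
          ρ   = rootℚ n a
          t   = recip (suc n)
          b   = β ^ r
          x   = mean (λ e → φ (πᴱ e)) (S′ r v₀) - mean φ E
          y   = C * (ρ + t) * b
          0≤b = ^-nonNeg 0≤β r
          0≤C = ℚ.<⇒≤ C-pos
          0≤t = ℚ.<⇒≤ (recip-pos n)
          norm²≤ : norm² φ ≤ (ρ + t) ²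
          norm²≤ = subst (_≤ (ρ + t) ²) (seq-sumᴿ (λ e → f e *ᴿ f e) E n) (ℚ.<⇒≤ (rootℚ-upper n a))
          x²≤y² : x ² ≤ y ²
          x²≤y² = begin
            x ²                           ≤⟨ deviation-≤ φ root r v₀ ⟩
            C ² * norm² φ * b ²       ≤⟨ *-monoˡ (²-nonNeg b) (*-monoʳ (²-nonNeg C) norm²≤) ⟩
            C ² * (ρ + t) ² * b ²     ≡⟨ solve 3 (λ c s b → c :* c :* (s :* s) :* (b :* b)
                                               := c :* s :* b :* (c :* s :* b)) refl C (ρ + t) b ⟩
            y ²                           ∎
      in begin
        ∣ seq (M r v₀ f) n - seq (average f) n ∣
          ≡⟨ cong₂ (λ m m′ → ∣ m - m′ ∣) (seq-meanᴿ (lift f) (S′ r v₀) n) (seq-meanᴿ f E n) ⟩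
        ∣ x ∣
          ≤⟨ ²-cancel-≤ (*-nonNeg (*-nonNeg 0≤C (ℚ.+-mono-≤ (rootℚ-nonNeg n a) 0≤t)) 0≤b) x²≤y² ⟩
        C * (ρ + t) * b
          ≡⟨ solve 4 (λ c s t b → c :* (s :+ t) :* b := c :* s :* b :+ c :* t :* b) refl C ρ t b ⟩
        C * ρ * b + C * t * b
          ≤⟨ ℚ.+-monoʳ-≤ (C * ρ * b) (begin
               C * t * b          ≤⟨ *-monoʳ (*-nonNeg 0≤C 0≤t) (^-≤1 0≤β (ℚ.<⇒≤ β<1) r) ⟩
               C * t * 1ℚ         ≡⟨ ℚ.*-identityʳ (C * t) ⟩
               C * t                ≤⟨ *-monoʳ 0≤C (t≤ n N≤n) ⟩
               C * (1/C * ε)      ≡⟨ ℚ.*-assoc C 1/C ε ⟨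
               C * 1/C * ε        ≡⟨ cong (_* ε) (ℚ.*-inverseʳ C {{C≢0}}) ⟩
               1ℚ * ε               ≡⟨ ℚ.*-identityˡ ε ⟩
               ε                      ∎) ⟩
        C * ρ * b + ε
          ≡⟨ cong (λ z → C * ρ * z + ε) (seq-^ᴿ β r n) ⟨
        seq (fromℚ C *ᴿ ‖ f ‖₂ *ᴿ fromℚ β ^ᴿ r) n + ε ∎
      where
      open UniversalCover G root
      C≢0 = ℚ.>-nonZero C-pos
      1/C = ℚ.1/_ C {{C≢0}}
      0<ε/C : 0ℚ < 1/C * ε
      0<ε/C = *-positive (ℚ.positive⁻¹ 1/C {{ℚ.1/pos⇒pos C {{ℚ.positive C-pos}}}}) 0<ε
      -- From this index on, the rounding error `t` is at most ε / C.
      N = proj₁ (archimedean (1/C * ε) 0<ε/C)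
      t≤ = proj₂ (archimedean (1/C * ε) 0<ε/C)

open import Data.Nat.Base using (_≤_; _*_)

theorem3 : (p q : ℕ) → 2 ≤ p → 2 ≤ q →
    (G : SimpleGraph) → Semiregular p q G →
    let open SimpleGraph G in
    ∃[ C ] ∃[ β ]
    0ᴿ <ᴿ C × √ √ fromℚ (recip (p * q)) ≤ᴿ β × β <ᴿ 1ᴿ ×
    ((root : Vertex) → let open UniversalCover G root in
    (f : Edge → ℝ) (v₀ : Path) (r : ℕ) →
    ∣ M r v₀ f -ᴿ average f ∣ᴿ ≤ᴿ C *ᴿ ‖ f ‖₂ *ᴿ β ^ᴿ r)
theorem3 p q 2≤p 2≤q G semiregular =
  fromℚ C , fromℚ β , fromℚ-<ᴿ C-pos , β-large , fromℚ-<ᴿ β<1 , estimate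
  where
  open Mixing using (fromℚ-<ᴿ)
  open Mixing.Contraction p q 2≤p 2≤q G semiregular using (β; β<1)
  open Mixing.Means p q 2≤p 2≤q G semiregular using (C; C-pos; β-large; estimate)
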